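{- For every $n\ge 1$, the edge labeling $\lambda_w$ of the weighted partition poset $\Pi_n^w$ is an EW-labeling. Consequently, $\Pi_n^w$ has a Whitney dual.
   Context: A weighted set is a pair $(A,v)$, written $A^v$, where $A$ is a nonempty finite set and $v\in\{0,\dots,|A|-1\}$. A weighted partition of $[n]$ is a collection $B_1^{v_1}/\cdots/B_t^{v_t}$ of weighted sets such that $B_1/\cdots/B_t$ is a set partition of $[n]$. The poset $\Pi_n^w$ is the set of weighted partitions of $[n]$ with cover relations $\pi\lessdot\pi'$ exactly when $\pi'$ is obtained from $\pi$ by replacing two blocks $A^{a},B^{b}$ by the single block $(A\cup B)^{a+b+u}$ for some $u\in\{0,1\}$, all other blocks unchanged. Its minimum is $\hat0=\{1\}^0/\cdots/\{n\}^0$; it is graded with rank $n$ minus the number of blocks. Label poset $\Lambda_n^w$: for $a\in[n-1]$ let $\Gamma_a=\{(a,b)^u: a<b\le n,\ u\in\{0,1\}\}$ ordered by $(a,b)^u\le(a,c)^v$ iff $b\le c$ and $u\le v$; $\Lambda_n^w=\Gamma_1\oplus\Gamma_2\oplus\cdots\oplus\Gamma_{n-1}$ is the ordinal sum (every element of $\Gamma_a$ is below every element of $\Gamma_{a'}$ when $a<a'$). The labeling $\lambda_w$ assigns to the cover obtained by merging $A^{a}$ and $B^{b}$ into $(A\cup B)^{a+b+u}$, with $\min A<\min B$, the label $(\min A,\min B)^u$. An edge labeling $\lambda$ of a poset $P$ assigns to each cover relation an element of a poset $\Lambda$. A saturated chain $x_0\lessdot\cdots\lessdot x_m$ is increasing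 if $\lambda(x_{i-1}\lessdot x_i)<\lambda(x_i\lessdot x_{i+1})$ for all $i$, and ascent-free if $\lambda(x_{i-1}\lessdot x_i)\not<\lambda(x_i\lessdot x_{i+1})$ for all $i$. $\lambda$ is an ER-labeling if every closed interval has a unique increasing maximal chain. $\lambda$ is an EW-labeling if (1) it is an ER-labeling; (2) (rank two switching) for every interval $[x,y]$ with $\rho(y)-\rho(x)=2$, if its increasing chain has label sequence $ab$, then there is exactly one maximal chain of $[x,y]$ with label sequence $ba$; (3) for all $x<y$, distinct ascent-free maximal chains of $[x,y]$ have distinct label sequences. For a graded poset $P$ with minimum $\hat0$, the Whitney numbers are $w_k(P)=\sum_{\rho(x)=k}\mu(\hat0,x)$ (first kind) and $W_k(P)=\#\{x:\rho(x)=k\}$ (second kind). Graded posets $P,Q$ with minima are Whitney duals if $|w_k(P)|=W_k(Q)$ and $|w_k(Q)|=W_k(P)$ for all $k$. -}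

module Defs where

open import Data.Bool using (Bool; true; false; T; if_then_else_; _∧_; _∨_; not)
open import Data.Nat as ℕ using (ℕ; zero; suc; _+_; _∸_; _≤ᵇ_; _<ᵇ_; _≡ᵇ_)
open import Data.Fin as Fin using (Fin; toℕ)
open import Data.Fin.Properties using () renaming (_≟_ to _≟F_)
open import Data.Integer as ℤ using (ℤ; ∣_∣)
open import Data.List using (List; []; _∷_; map; filterᵇ; length; foldr; allFin; upTo; concatMap; cartesianProduct)
open import Data.Bool.ListAction using (all; any)
open import Data.List.Relation.Unary.Linked using (Linked)
open import Data.Vec as Vec using (Vec; lookup; tabulate; replicate)
open import Data.Vec.Properties using () renaming (≡-dec to ≡-decV)
open import Data.Product using (Σ; _×_; _,_; proj₁; proj₂)
open import Data.Product.Properties using () renaming (≡-dec to ≡-dec×)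
open import Data.Sum using (_⊎_)
open import Relation.Nullary using (¬_; ⌊_⌋)
open import Relation.Binary.PropositionalEquality using (_≡_; _≢_)

-- Generic edge-labeled posets given by a labeled cover relation.
-- Cov x ℓ y : "x ⋖ y and the cover has label ℓ".
-- Chain x y : saturated chains x = x₀ ⋖ x₁ ⋖ ⋯ ⋖ xₘ = y; in a finite graded
-- poset these are exactly the maximal chains of the interval [x,y], and
-- x ≤ y iff such a chain exists.

module EdgeLabeling {P Λ : Set} (_≺_ : Λ → Λ → Set) (Cov : P → Λ → P → Set) where

  data Chain : P → P → Set where
    done : ∀ {x} → Chain x x
    step : ∀ {x ℓ z y} → Cov x ℓ z → Chain z y → Chain x y

  elems : ∀ {x y} → Chain x y → List P
  elems {x} done       = x ∷ []
  elems {x} (step _ c) = x ∷ elems c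

  labels : ∀ {x y} → Chain x y → List Λ
  labels done                = []
  labels (step {ℓ = ℓ} _ c) = ℓ ∷ labels c

  Increasing : ∀ {x y} → Chain x y → Set
  Increasing c = Linked _≺_ (labels c)

  AscentFree : ∀ {x y} → Chain x y → Set
  AscentFree c = Linked (λ a b → ¬ (a ≺ b)) (labels c)

  -- D : the predicate singling out the elements of the poset
  -- (chains starting in D stay in D).
  -- ER: every closed interval [x,y] (x ≤ y) has a unique increasing maximal chain.
  IsER : (D : P → Set) → Set
  IsER D = ∀ x y → D x → Chain x y →
    Σ (Chain x y) Increasing ×
    (∀ (c₁ c₂ : Chain x y) → Increasing c₁ → Increasing c₂ → elems c₁ ≡ elems c₂)

  -- rank two switching: intervals of rank 2 are those whose maximal chains
  -- have length 2.
  RankTwoSwitching : (D : P → Set) → Set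
  RankTwoSwitching D = ∀ x y → D x → (c : Chain x y) → Increasing c →
    ∀ a b → labels c ≡ a ∷ b ∷ [] →
    Σ (Chain x y) (λ c' → labels c' ≡ b ∷ a ∷ []) ×
    (∀ (c₁ c₂ : Chain x y) → labels c₁ ≡ b ∷ a ∷ [] → labels c₂ ≡ b ∷ a ∷ [] →
       elems c₁ ≡ elems c₂)

  AscentFreeInjective : (D : P → Set) → Set
  AscentFreeInjective D = ∀ x y → D x → (c₁ c₂ : Chain x y) →
    AscentFree c₁ → AscentFree c₂ → labels c₁ ≡ labels c₂ → elems c₁ ≡ elems c₂

  IsEW : (D : P → Set) → Set
  IsEW D = IsER D × RankTwoSwitching D × AscentFreeInjective D

module Whitney {A : Set} (els : List A) (le : A → A → Bool) (bot : A) (rank : A → ℕ) where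

  lt : A → A → Bool
  lt x y = le x y ∧ not (le y x)

  sumℤ : List ℤ → ℤ
  sumℤ = foldr ℤ._+_ (ℤ.+ 0)

  -- μ(0̂,x) by the recursion μ(0̂,0̂)=1, μ(0̂,x) = -Σ_{0̂≤z<x} μ(0̂,z),
  -- computed with fuel (fuel |els| exceeds the length of every chain).
  mob : ℕ → A → ℤ
  mob zero    _ = ℤ.+ 0
  mob (suc k) x = if le x bot then ℤ.+ 1
                  else ℤ.- sumℤ (map (mob k) (filterᵇ (λ z → lt z x) els))

  μ₀ : A → ℤ
  μ₀ = mob (length els)

  ofRank : ℕ → List A
  ofRank k = filterᵇ (λ x → rank x ≡ᵇ k) els

  w : ℕ → ℤ
  w k = sumℤ (map μ₀ (ofRank k))

  W : ℕ → ℕ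
  W k = length (ofRank k)

record GradedPoset : Set where
  field
    m        : ℕ
    le       : Fin m → Fin m → Bool
    bot      : Fin m
    rank     : Fin m → ℕ
    le-refl  : ∀ x → T (le x x)
    le-antisym : ∀ x y → T (le x y) → T (le y x) → x ≡ y
    le-trans : ∀ x y z → T (le x y) → T (le y z) → T (le x z)
    bot-min  : ∀ x → T (le bot x)
    rank-bot : rank bot ≡ 0
    rank-cover : ∀ x y → T (le x y) → x ≢ y →
                 (∀ z → T (le x z) → T (le z y) → (z ≡ x) ⊎ (z ≡ y)) →
                 rank y ≡ suc (rank x)

-- Weighted partitions of [n] (elements are Fin n, i.e. 0..n-1).
-- A raw pair (f , w): f i = the minimum of the block containing i;
-- w r = weight of the block with minimum r (and w i = 0 if i is not a minimum).

Raw : ℕ → Set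
Raw n = Vec (Fin n) n × Vec ℕ n

_≟R_ : ∀ {n} (x y : Raw n) → _
_≟R_ {n} = ≡-dec× (≡-decV _≟F_) (≡-decV ℕ._≟_)

isMin : ∀ {n} → Raw n → Fin n → Bool
isMin (f , _) i = ⌊ lookup f i ≟F i ⌋

blockSize : ∀ {n} → Raw n → Fin n → ℕ
blockSize {n} (f , _) r = length (filterᵇ (λ j → ⌊ lookup f j ≟F r ⌋) (allFin n))

valid? : ∀ {n} → Raw n → Bool
valid? {n} x@(f , wt) = all cond (allFin n)
  where
  cond : Fin n → Bool
  cond i = ⌊ lookup f (lookup f i) ≟F lookup f i ⌋
         ∧ (toℕ (lookup f i) ≤ᵇ toℕ i)
         ∧ (if isMin x i then lookup wt i <ᵇ blockSize x i else lookup wt i ≡ᵇ 0)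

IsWeightedPartition : ∀ {n} → Raw n → Set
IsWeightedPartition x = T (valid? x)

merge : ∀ {n} → Raw n → Fin n → Fin n → Fin 2 → Raw n
merge (f , wt) a b u =
  ( Vec.map (λ r → if ⌊ r ≟F b ⌋ then a else r) f
  , tabulate (λ i → if ⌊ i ≟F a ⌋ then lookup wt a + lookup wt b + toℕ u
                    else if ⌊ i ≟F b ⌋ then 0 else lookup wt i) )

Label : ℕ → Set
Label n = Fin n × Fin n × Fin 2

-- order of Λ_n^w = Γ₁ ⊕ ⋯ ⊕ Γ_{n-1}
_≤Λ_ : ∀ {n} → Label n → Label n → Set
(a , b , u) ≤Λ (a' , b' , u') = (a Fin.< a') ⊎ ((a ≡ a') × (b Fin.≤ b') × (u Fin.≤ u'))

_<Λ_ : ∀ {n} → Label n → Label n → Set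
ℓ <Λ ℓ' = (ℓ ≤Λ ℓ') × (ℓ ≢ ℓ')

-- labeled cover relation of Π_n^w with the labeling λ_w:
-- merging A^{v_A}, B^{v_B} (min A = a < b = min B) into (A∪B)^{v_A+v_B+u}
-- has label (a,b)^u.
WCover : ∀ {n} → Raw n → Label n → Raw n → Set
WCover x (a , b , u) y =
  (isMin x a ≡ true) × (isMin x b ≡ true) × (a Fin.< b) × (y ≡ merge x a b u)

module ΠwLabeling (n : ℕ) = EdgeLabeling {Raw n} {Label n} _<Λ_ WCover

λw-IsEW : ℕ → Set
λw-IsEW n = ΠwLabeling.IsEW n IsWeightedPartition

allVecs : ∀ {A : Set} (k : ℕ) → List A → List (Vec A k)
allVecs zero    xs = Vec.[] ∷ []
allVecs (suc k) xs = concatMap (λ x → map (x Vec.∷_) (allVecs k xs)) xs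

-- all weighted partitions (weights are < n)
Πw-elems : (n : ℕ) → List (Raw n)
Πw-elems n = filterᵇ valid? (cartesianProduct (allVecs n (allFin n)) (allVecs n (upTo n)))

allLabels : (n : ℕ) → List (Label n)
allLabels n = cartesianProduct (allFin n) (cartesianProduct (allFin n) (allFin 2))

isCover? : ∀ {n} → Raw n → Label n → Bool
isCover? x (a , b , u) = isMin x a ∧ isMin x b ∧ (toℕ a <ᵇ toℕ b)

reach? : ∀ {n} → ℕ → Raw n → Raw n → Bool
reach? zero    x y = ⌊ x ≟R y ⌋
reach? {n} (suc k) x y = ⌊ x ≟R y ⌋ ∨
  any (λ { ℓ@(a , b , u) → isCover? x ℓ ∧ reach? k (merge x a b u) y }) (allLabels n)

-- order of Π_n^w (every chain has at most n-1 covers)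
Πw-le : (n : ℕ) → Raw n → Raw n → Bool
Πw-le n = reach? n

Πw-bot : (n : ℕ) → Raw n
Πw-bot n = tabulate (λ i → i) , replicate n 0

Πw-rank : (n : ℕ) → Raw n → ℕ
Πw-rank n x = n ∸ length (filterᵇ (isMin x) (allFin n))

module ΠwW (n : ℕ) = Whitney (Πw-elems n) (Πw-le n) (Πw-bot n) (Πw-rank n)
module QW (Q : GradedPoset) = Whitney (allFin (GradedPoset.m Q)) (GradedPoset.le Q)
                                      (GradedPoset.bot Q) (GradedPoset.rank Q)

IsWhitneyDualOfΠw : ℕ → GradedPoset → Set
IsWhitneyDualOfΠw n Q = ∀ k →
  (∣ ΠwW.w n k ∣ ≡ QW.W Q k) × (∣ QW.w Q k ∣ ≡ ΠwW.W n k)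

HasWhitneyDual-Πw : ℕ → Set
HasWhitneyDual-Πw n = Σ GradedPoset (IsWhitneyDualOfΠw n)

module Submission where

-- EW-labeling.  A merge is determined by its label, so chains are determined by
-- their labels.  Write x ⊑ y if x refines y and every block of y, made of k
-- blocks of x, has weight between the sum of their weights and that sum plus
-- k - 1; this is x ≤ y.  The first label (a , b)^u of an increasing chain from x
-- to y is forced: a is the least minimum of a block of y that is not a block of
-- x, b is the second smallest minimum of a block of x inside it, and u = 1 iff
-- the weight of that block of y is the largest possible.  Choosing the largest
-- pair (a , b) instead gives ascent-free chains.
--
-- Whitney dual.  Grouping the pairs (ascent-free chain 0̂ → t, increasing chain
-- t → x) by the concatenated chain gives (-1)^ρ(x) μ(0̂,x) = number of
-- ascent-free maximal chains of [0̂ , x] ≥ 1, hence W_k ≤ |w_k|, with equality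
-- for k ≤ 1.  Together with the fact that W_{k+2} > 0 forces W_{k+1} ≥ 2, these
-- inequalities alone suffice to build a dual: an iterated ordinal sum of pairs
-- of elements, each level padded with elements of the right Möbius value.

open import Defs
open import Algebra.Structures using (IsCommutativeMonoid)
open import Data.Bool using (Bool; true; false; T; if_then_else_; _∧_; not)
open import Data.Bool.Properties using (T-≡; T-∧; T-∨; T?)
open import Data.Fin as Fin using (Fin; toℕ)
import Data.Fin.Properties as Finₚ
open import Data.Fin.Properties using () renaming (_≟_ to _≟F_)
open import Data.Integer as ℤ using (ℤ)
import Data.Integer.Properties as ℤₚ
open import Data.List
  using (List; []; _∷_; _++_; allFin; cartesianProduct; concatMap; filterᵇ; foldr; length; lookup; map; upTo)
import Data.List.Properties as Listₚ
open import Data.List.Membership.Propositional using (_∈_; find; lose)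
open import Data.List.Membership.Propositional.Properties
  using (∈-allFin; ∈-cartesianProduct⁺; ∈-concatMap⁺; ∈-concatMap⁻; ∈-filter⁺; ∈-filter⁻; ∈-lookup;
         ∈-map⁺; ∈-map⁻; ∈-upTo⁺; ∈-upTo⁻)
open import Data.List.Relation.Unary.All as All using (All; []; _∷_)
import Data.List.Relation.Unary.All.Properties as Allₚ
open import Data.List.Relation.Unary.AllPairs as AllPairs using (AllPairs; []; _∷_)
import Data.List.Relation.Unary.AllPairs.Properties as AllPairsₚ
open import Data.List.Relation.Unary.Any as Any using (here; there; satisfied)
open import Data.List.Relation.Unary.Any.Properties using (any⁺; any⁻; lookup-index)
open import Data.List.Relation.Unary.Linked as Linked using (Linked; []; [-]; _∷_)
open import Data.List.Relation.Unary.Unique.Propositional using (Unique)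
import Data.List.Relation.Unary.Unique.Propositional.Properties as Uniqueₚ
open import Data.Nat as ℕ using (ℕ; zero; suc; _+_; _∸_; _≤_; _<_; z≤n; s≤s)
import Data.Nat.Properties as ℕₚ
open import Data.Nat.Tactic.RingSolver using (solve-∀)
open import Data.Product using (Σ; ∃; _×_; _,_; proj₁; proj₂)
open import Data.Product.Properties using () renaming (≡-dec to ≡-dec×)
open import Data.Sum using (_⊎_; inj₁; inj₂)
open import Data.Vec as Vec using (Vec)
open import Data.Vec.Properties using (lookup-map; lookup∘tabulate; lookup-replicate; tabulate∘lookup; tabulate-cong)
open import Function using (_∘_; case_of_; flip; Equivalence)
open import Relation.Binary using (Transitive; tri<; tri≈; tri>)
open import Relation.Binary.PropositionalEquality
open import Relation.Nullary using (¬_; Dec; yes; no; ⌊_⌋; contradiction)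
open import Relation.Nullary.Decidable using (_×-dec_; _⊎-dec_; ¬?; decidable-stable; fromWitness; toWitness)
open import Relation.Unary using (Decidable)

-- Inside a block of `y`, weight plus number of blocks drops by one under a 0-merge and is kept by a
-- 1-merge, so the remaining drop is the number of 0-merges still owed. Along an increasing chain
-- the bits inside one block grow weakly, hence the owed 0-merges come first and the leading bit is
-- 1 exactly when none is owed.
--
-- The pairs behind the Möbius value cancel because a nonempty chain that splits as ascent-free
-- followed by increasing does so at exactly two adjacent points, whose ranks have opposite signs.
--
-- In the dual, the two elements chosen in rank `k ≥ 1` both have Möbius value (-1)^k, so the chosen
-- values add up to (-1)^k over the ranks 0 to `k`. An element of rank `k + 1` above both chosen
-- elements of rank `k` therefore gets (-1)^(k+1), and one above only the first gets 0. Rank 0 has a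
-- single element and leaves no such choice for rank 1, which is why the equality at `k = 1` belongs
-- to the input.

private variable n : ℕ

-- Finite sums

χ : Bool → ℕ
χ b = if b then 1 else 0

if-true : ∀ {A : Set} {b} {x y : A} → b ≡ true → (if b then x else y) ≡ x
if-true refl = refl

if-false : ∀ {A : Set} {b} {x y : A} → b ≡ false → (if b then x else y) ≡ y
if-false refl = refl

¬T⇒≡false : ∀ {b} → ¬ T b → b ≡ false
¬T⇒≡false {true}  h = contradiction _ h
¬T⇒≡false {false} h = refl

T⇒≡true : ∀ {b} → T b → b ≡ true
T⇒≡true {true} _ = refl

module FiniteSum {C : Set} {_∙_ : C → C → C} {ε : C}
                 (isCommutativeMonoid : IsCommutativeMonoid _≡_ _∙_ ε) where

  open IsCommutativeMonoid isCommutativeMonoid using (assoc; comm; identityˡ; identityʳ)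

  ∑ : {A : Set} → (A → C) → List A → C
  ∑ f []      = ε
  ∑ f (x ∷ L) = f x ∙ ∑ f L

  ∑-foldr : ∀ {A : Set} (f : A → C) L → foldr _∙_ ε (map f L) ≡ ∑ f L
  ∑-foldr f []      = refl
  ∑-foldr f (x ∷ L) = cong (f x ∙_) (∑-foldr f L)

  interchange : ∀ a b c d → (a ∙ b) ∙ (c ∙ d) ≡ (a ∙ c) ∙ (b ∙ d)
  interchange a b c d = begin
    (a ∙ b) ∙ (c ∙ d) ≡⟨ assoc a b _ ⟩
    a ∙ (b ∙ (c ∙ d)) ≡⟨ cong (a ∙_) (assoc b c d) ⟨
    a ∙ ((b ∙ c) ∙ d) ≡⟨ cong (λ z → a ∙ (z ∙ d)) (comm b c) ⟩
    a ∙ ((c ∙ b) ∙ d) ≡⟨ cong (a ∙_) (assoc c b d) ⟩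
    a ∙ (c ∙ (b ∙ d)) ≡⟨ assoc a c _ ⟨
    (a ∙ c) ∙ (b ∙ d) ∎
    where open ≡-Reasoning

  module _ {A : Set} where

    ∑-cong : ∀ {f g : A → C} L → (∀ {x} → x ∈ L → f x ≡ g x) → ∑ f L ≡ ∑ g L
    ∑-cong []      eq = refl
    ∑-cong (x ∷ L) eq = cong₂ _∙_ (eq (here refl)) (∑-cong L (eq ∘ there))

    ∑-zero : ∀ {f : A → C} L → (∀ {x} → x ∈ L → f x ≡ ε) → ∑ f L ≡ ε
    ∑-zero []      eq = refl
    ∑-zero (x ∷ L) eq =
      trans (cong₂ _∙_ (eq (here refl)) (∑-zero L (eq ∘ there))) (identityˡ ε)

    ∑-∙ : ∀ (f g : A → C) L → ∑ (λ x → f x ∙ g x) L ≡ ∑ f L ∙ ∑ g L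
    ∑-∙ f g []      = sym (identityˡ ε)
    ∑-∙ f g (x ∷ L) =
      trans (cong ((f x ∙ g x) ∙_) (∑-∙ f g L)) (interchange (f x) (g x) _ _)

    ∑-++ : ∀ (f : A → C) L M → ∑ f (L ++ M) ≡ ∑ f L ∙ ∑ f M
    ∑-++ f []      M = sym (identityˡ _)
    ∑-++ f (x ∷ L) M = trans (cong (f x ∙_) (∑-++ f L M)) (sym (assoc (f x) _ _))

    ∑-filterᵇ : ∀ (f : A → C) p L →
                ∑ f (filterᵇ p L) ≡ ∑ (λ x → if p x then f x else ε) L
    ∑-filterᵇ f p []      = refl
    ∑-filterᵇ f p (x ∷ L) with p x
    ... | true  = cong (f x ∙_) (∑-filterᵇ f p L)
    ... | false = trans (∑-filterᵇ f p L) (sym (identityˡ _))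

    ∑-single : ∀ {f : A → C} {x} L → Unique L → x ∈ L →
               (∀ {y} → y ∈ L → y ≢ x → f y ≡ ε) → ∑ f L ≡ f x
    ∑-single {f} (x ∷ L) (x∉L ∷ _) (here refl) off =
      trans (cong (f x ∙_) (∑-zero L λ y∈L →
               off (there y∈L) λ y≡x → All.lookup x∉L y∈L (sym y≡x)))
            (identityʳ _)
    ∑-single (y ∷ L) (y∉L ∷ uL) (there x∈L) off =
      trans (cong₂ _∙_ (off (here refl) (All.lookup y∉L x∈L))
                       (∑-single L uL x∈L (off ∘ there)))
            (identityˡ _)

  module _ {A B : Set} where

    ∑-map : ∀ (f : B → C) (g : A → B) L → ∑ f (map g L) ≡ ∑ (f ∘ g) L
    ∑-map f g []      = refl
    ∑-map f g (x ∷ L) = cong (f (g x) ∙_) (∑-map f g L)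

    ∑-concatMap : ∀ (f : B → C) (g : A → List B) L →
                  ∑ f (concatMap g L) ≡ ∑ (λ x → ∑ f (g x)) L
    ∑-concatMap f g []      = refl
    ∑-concatMap f g (x ∷ L) =
      trans (∑-++ f (g x) (concatMap g L)) (cong (∑ f (g x) ∙_) (∑-concatMap f g L))

    ∑-swap : ∀ (f : A → B → C) L M →
             ∑ (λ x → ∑ (f x) M) L ≡ ∑ (λ y → ∑ (λ x → f x y) L) M
    ∑-swap f []      M = sym (∑-zero M λ _ → refl)
    ∑-swap f (x ∷ L) M =
      trans (cong (∑ (f x) M ∙_) (∑-swap f L M))
            (sym (∑-∙ (f x) (λ y → ∑ (λ x → f x y) L) M))

  if-∑ : ∀ {A : Set} b (f : A → C) L →
         (if b then ∑ f L else ε) ≡ ∑ (λ x → if b then f x else ε) L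
  if-∑ true  f L = refl
  if-∑ false f L = sym (∑-zero L λ _ → refl)

  if-∙ : ∀ b {c d} → (if b then c ∙ d else ε) ≡ (if b then c else ε) ∙ (if b then d else ε)
  if-∙ true  = refl
  if-∙ false = sym (identityˡ ε)

  -- Moves sums from positions in a list to its entries: the dual has to live on some `Fin m`, but
  -- is described by a list of pairs.
  ∑-reindex : ∀ {A : Set} (f : A → C) p L →
              ∑ (f ∘ lookup L) (filterᵇ (p ∘ lookup L) (allFin (length L))) ≡ ∑ f (filterᵇ p L)
  ∑-reindex f p L = begin
    ∑ (f ∘ lookup L) (filterᵇ (p ∘ lookup L) (allFin (length L)))
      ≡⟨ ∑-filterᵇ (f ∘ lookup L) (p ∘ lookup L) (allFin (length L)) ⟩
    ∑ (g ∘ lookup L) (allFin (length L))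
      ≡⟨ ∑-map g (lookup L) (allFin (length L)) ⟨
    ∑ g (map (lookup L) (allFin (length L)))
      ≡⟨ cong (∑ g) (trans (Listₚ.map-tabulate (λ i → i) (lookup L)) (Listₚ.tabulate-lookup L)) ⟩
    ∑ g L
      ≡⟨ ∑-filterᵇ f p L ⟨
    ∑ f (filterᵇ p L) ∎
    where
    open ≡-Reasoning
    g = λ x → if p x then f x else ε

  ∑-upTo-suc : ∀ (f : ℕ → C) m → ∑ f (upTo (suc m)) ≡ ∑ f (upTo m) ∙ f m
  ∑-upTo-suc f m = trans (cong (∑ f) (sym (Listₚ.upTo-∷ʳ m)))
    (trans (∑-++ f (upTo m) (m ∷ [])) (cong (∑ f (upTo m) ∙_) (identityʳ (f m))))

  ∑-upTo-stable : ∀ (f : ℕ → C) {m k} → m ≤ k → (∀ {j} → m ≤ j → f j ≡ ε) →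
                  ∑ f (upTo k) ≡ ∑ f (upTo m)
  ∑-upTo-stable f {m} {k} m≤k f≡ε = go k m≤k
    where
    go : ∀ k → m ≤ k → ∑ f (upTo k) ≡ ∑ f (upTo m)
    go k m≤k with m ℕ.≟ k
    go k m≤k | yes refl = refl
    go zero m≤k | no m≢k = contradiction (ℕₚ.n≤0⇒n≡0 m≤k) m≢k
    go (suc k) m≤k | no m≢k = trans (∑-upTo-suc f k)
      (trans (cong₂ _∙_ (go k m≤k') (f≡ε m≤k')) (identityʳ _))
      where m≤k' = ℕₚ.≤-pred (ℕₚ.≤∧≢⇒< m≤k m≢k)

  -- The list is the element list of a ladder, with `a l` elements in each rank `l < N`; for `k`
  -- outside that range both sides are empty by the hypothesis on `a`.
  ∑-fibre : ∀ (a : ℕ → ℕ) N → (∀ k → N ≤ k → a k ≡ 0) → ∀ (f : ℕ × ℕ → C) k →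
            ∑ f (filterᵇ (λ x → proj₁ x ℕ.≡ᵇ k) (concatMap (λ l → map (l ,_) (upTo (a l))) (upTo N))) ≡
            ∑ (λ j → f (k , j)) (upTo (a k))
  ∑-fibre a N a≡0 f k = trans (∑-filterᵇ f (λ x → proj₁ x ℕ.≡ᵇ k) (concatMap _ (upTo N)))
    (trans (∑-concatMap _ _ (upTo N)) (trans (∑-cong (upTo N) λ {l} _ → ∑-map _ (l ,_) (upTo (a l))) fibre))
    where
    row : ℕ → C
    row l = ∑ (λ j → if l ℕ.≡ᵇ k then f (l , j) else ε) (upTo (a l))
    row≢ : ∀ {l} → l ≢ k → row l ≡ ε
    row≢ {l} l≢k = ∑-zero (upTo (a l)) λ _ → if-false (¬T⇒≡false (l≢k ∘ ℕₚ.≡ᵇ⇒≡ l k))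
    row≡ : row k ≡ ∑ (λ j → f (k , j)) (upTo (a k))
    row≡ = ∑-cong (upTo (a k)) λ _ → if-true (T⇒≡true (ℕₚ.≡⇒≡ᵇ k k refl))
    fibre : ∑ row (upTo N) ≡ ∑ (λ j → f (k , j)) (upTo (a k))
    fibre with N ℕ.≤? k
    ... | yes N≤k = trans (∑-zero (upTo N) λ l∈ → row≢ (ℕₚ.<⇒≢ (ℕₚ.<-≤-trans (∈-upTo⁻ l∈) N≤k)))
                      (sym (cong (λ m → ∑ (λ j → f (k , j)) (upTo m)) (a≡0 k N≤k)))
    ... | no N≰k  = trans (∑-single (upTo N) (Uniqueₚ.upTo⁺ N) (∈-upTo⁺ (ℕₚ.≰⇒> N≰k)) λ _ → row≢) row≡

open FiniteSum ℕₚ.+-0-isCommutativeMonoid public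
module ℤΣ = FiniteSum ℤₚ.+-0-isCommutativeMonoid

module _ {A : Set} where

  length-∑ : ∀ (L : List A) → length L ≡ ∑ (λ _ → 1) L
  length-∑ []      = refl
  length-∑ (x ∷ L) = cong suc (length-∑ L)

  length-filterᵇ-∑ : ∀ p (L : List A) → length (filterᵇ p L) ≡ ∑ (χ ∘ p) L
  length-filterᵇ-∑ p L = trans (length-∑ (filterᵇ p L)) (∑-filterᵇ _ p L)

  ∑-mono-≤ : ∀ {f g : A → ℕ} L → (∀ {x} → x ∈ L → f x ≤ g x) → ∑ f L ≤ ∑ g L
  ∑-mono-≤ []      le = z≤n
  ∑-mono-≤ (x ∷ L) le = ℕₚ.+-mono-≤ (le (here refl)) (∑-mono-≤ L (le ∘ there))

  ∑-mono-< : ∀ {f g : A → ℕ} {y} L → (∀ {x} → x ∈ L → f x ≤ g x) →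
             y ∈ L → f y < g y → ∑ f L < ∑ g L
  ∑-mono-< (x ∷ L) le (here refl) lt = ℕₚ.+-mono-<-≤ lt (∑-mono-≤ L (le ∘ there))
  ∑-mono-< (x ∷ L) le (there y∈L) lt =
    ℕₚ.+-mono-≤-< (le (here refl)) (∑-mono-< L (le ∘ there) y∈L lt)

  term≤∑ : ∀ (f : A → ℕ) {x} L → x ∈ L → f x ≤ ∑ f L
  term≤∑ f (x ∷ L) (here refl) = ℕₚ.m≤m+n (f x) _
  term≤∑ f (y ∷ L) (there x∈L) = ℕₚ.≤-trans (term≤∑ f L x∈L) (ℕₚ.m≤n+m _ (f y))

  pos-∑ : ∀ (f : A → ℕ) L → ℤ.+ (∑ f L) ≡ ℤΣ.∑ (λ x → ℤ.+ f x) L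
  pos-∑ f []      = refl
  pos-∑ f (x ∷ L) = cong (λ z → (ℤ.+ f x) ℤ.+ z) (pos-∑ f L)

  *-∑ : ∀ c (f : A → ℤ) L → c ℤ.* ℤΣ.∑ f L ≡ ℤΣ.∑ (λ x → c ℤ.* f x) L
  *-∑ c f []      = ℤₚ.*-zeroʳ c
  *-∑ c f (x ∷ L) =
    trans (ℤₚ.*-distribˡ-+ c (f x) _) (cong (λ z → c ℤ.* f x ℤ.+ z) (*-∑ c f L))

-- Raw pairs as functions, and validity

fn : Raw n → Fin n → Fin n
fn x = Vec.lookup (proj₁ x)

wt : Raw n → Fin n → ℕ
wt x = Vec.lookup (proj₂ x)

lookup-ext : ∀ {A : Set} {u v : Vec A n} → (∀ i → Vec.lookup u i ≡ Vec.lookup v i) → u ≡ v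
lookup-ext {u = u} {v} eq =
  trans (sym (tabulate∘lookup u)) (trans (tabulate-cong eq) (tabulate∘lookup v))

raw-ext : {x y : Raw n} → (∀ i → fn x i ≡ fn y i) → (∀ i → wt x i ≡ wt y i) → x ≡ y
raw-ext fn≡ wt≡ = cong₂ _,_ (lookup-ext fn≡) (lookup-ext wt≡)

⌊≟⌋-true : {i j : Fin n} → i ≡ j → ⌊ i ≟F j ⌋ ≡ true
⌊≟⌋-true {i = i} {j} p with i ≟F j
... | yes _ = refl
... | no ¬p = contradiction p ¬p

⌊≟⌋-false : {i j : Fin n} → i ≢ j → ⌊ i ≟F j ⌋ ≡ false
⌊≟⌋-false {i = i} {j} ¬p with i ≟F j
... | yes p = contradiction p ¬p
... | no _  = refl

⌊≟⌋-true⁻ : {i j : Fin n} → ⌊ i ≟F j ⌋ ≡ true → i ≡ j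
⌊≟⌋-true⁻ {i = i} {j} eq with i ≟F j
... | yes p = p

⌊≟⌋-iff : {i j k l : Fin n} → (i ≡ j → k ≡ l) → (k ≡ l → i ≡ j) → ⌊ i ≟F j ⌋ ≡ ⌊ k ≟F l ⌋
⌊≟⌋-iff {i = i} {j} f g with i ≟F j
... | yes p = sym (⌊≟⌋-true (f p))
... | no ¬p = sym (⌊≟⌋-false (¬p ∘ g))

record Valid (x : Raw n) : Set where
  field
    idem : ∀ i → fn x (fn x i) ≡ fn x i
    low  : ∀ i → fn x i Fin.≤ i
    wt<  : ∀ i → fn x i ≡ i → wt x i < blockSize x i
    wt0  : ∀ i → fn x i ≢ i → wt x i ≡ 0

open Valid public

valid⇒ : (x : Raw n) → IsWeightedPartition x → Valid x
valid⇒ {n} x vx = record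
  { idem = λ i → toWitness (proj₁ (cond i))
  ; low  = λ i → ℕₚ.≤ᵇ⇒≤ _ _ (proj₁ (Equivalence.to T-∧ (proj₂ (cond i))))
  ; wt<  = λ i p → ℕₚ.<ᵇ⇒< _ _ (subst T (if-true (⌊≟⌋-true p)) (bound i))
  ; wt0  = λ i p → ℕₚ.≡ᵇ⇒≡ _ _ (subst T (if-false (⌊≟⌋-false p)) (bound i)) }
  where
  cond = λ i → Equivalence.to (T-∧ {⌊ fn x (fn x i) ≟F fn x i ⌋}) (All.lookup (Allₚ.all⁺ _ (allFin n) vx) (∈-allFin i))
  bound = λ i → proj₂ (Equivalence.to T-∧ (proj₂ (cond i)))

valid⇐ : (x : Raw n) → Valid x → IsWeightedPartition x
valid⇐ {n} x vx = Allₚ.all⁻ _ {xs = allFin n} (All.tabulate λ {i} _ →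
  Equivalence.from (T-∧ {⌊ fn x (fn x i) ≟F fn x i ⌋}) (fromWitness (idem vx i) ,
  Equivalence.from T-∧ (ℕₚ.≤⇒≤ᵇ (low vx i) , bound i)))
  where
  bound : ∀ i → T (if isMin x i then wt x i ℕ.<ᵇ blockSize x i else wt x i ℕ.≡ᵇ 0)
  bound i with fn x i ≟F i
  ... | yes p = ℕₚ.<⇒<ᵇ (wt< vx i p)
  ... | no ¬p = ℕₚ.≡⇒≡ᵇ _ _ (wt0 vx i ¬p)

-- Merging

infixl 7 _⋆_
_⋆_ : Raw n → Label n → Raw n
x ⋆ (a , b , u) = merge x a b u

Mergeable : Raw n → Label n → Set
Mergeable x (a , b , u) = (fn x a ≡ a) × (fn x b ≡ b) × (a Fin.< b)

cover⇒ : (x : Raw n) (ℓ : Label n) {y : Raw n} → WCover x ℓ y → Mergeable x ℓ × y ≡ x ⋆ ℓ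
cover⇒ _ _ (ma , mb , a<b , eq) = (⌊≟⌋-true⁻ ma , ⌊≟⌋-true⁻ mb , a<b) , eq

cover⇐ : (x : Raw n) (ℓ : Label n) → Mergeable x ℓ → WCover x ℓ (x ⋆ ℓ)
cover⇐ _ ℓ (ma , mb , a<b) = ⌊≟⌋-true ma , ⌊≟⌋-true mb , a<b , refl

module _ (x : Raw n) (a b : Fin n) (u : Fin 2) where

  private x' = merge x a b u

  fn-merge : ∀ i → fn x' i ≡ (if ⌊ fn x i ≟F b ⌋ then a else fn x i)
  fn-merge i = lookup-map i _ (proj₁ x)

  fn-merge-≡ : ∀ {i} → fn x i ≡ b → fn x' i ≡ a
  fn-merge-≡ {i} p = trans (fn-merge i) (if-true (⌊≟⌋-true p))

  fn-merge-≢ : ∀ {i} → fn x i ≢ b → fn x' i ≡ fn x i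
  fn-merge-≢ {i} p = trans (fn-merge i) (if-false (⌊≟⌋-false p))

  private
    wt-merge : ∀ i → wt x' i ≡ (if ⌊ i ≟F a ⌋ then wt x a + wt x b + toℕ u
                                else if ⌊ i ≟F b ⌋ then 0 else wt x i)
    wt-merge = lookup∘tabulate _

  wt-merge-a : ∀ {i} → i ≡ a → wt x' i ≡ wt x a + wt x b + toℕ u
  wt-merge-a {i} p = trans (wt-merge i) (if-true (⌊≟⌋-true p))

  wt-merge-b : ∀ {i} → i ≢ a → i ≡ b → wt x' i ≡ 0
  wt-merge-b {i} p q =
    trans (wt-merge i) (trans (if-false (⌊≟⌋-false p)) (if-true (⌊≟⌋-true q)))

  wt-merge-≢ : ∀ {i} → i ≢ a → i ≢ b → wt x' i ≡ wt x i
  wt-merge-≢ {i} p q =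
    trans (wt-merge i) (trans (if-false (⌊≟⌋-false p)) (if-false (⌊≟⌋-false q)))

blockSize-∑ : ∀ {n} (x : Raw n) r → blockSize x r ≡ ∑ (λ j → χ ⌊ fn x j ≟F r ⌋) (allFin n)
blockSize-∑ {n} x r = length-filterᵇ-∑ (λ j → ⌊ fn x j ≟F r ⌋) (allFin n)

-- Points that are not minima carry weight 0 in a valid partition, so the sum over all points of `c`
-- is the total weight of the blocks whose minimum lies in `c`.
weightIn : (Fin n → Bool) → Raw n → ℕ
weightIn {n} c x = ∑ (λ i → if c i then wt x i else 0) (allFin n)

minsIn : (Fin n → Bool) → Raw n → ℕ
minsIn {n} c x = ∑ (λ i → if c i then χ (isMin x i) else 0) (allFin n)

∑-allFin-single : ∀ {f : Fin n → ℕ} i → (∀ j → j ≢ i → f j ≡ 0) → ∑ f (allFin n) ≡ f i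
∑-allFin-single i off = ∑-single (allFin _) (Uniqueₚ.allFin⁺ _) (∈-allFin i) λ _ → off _

∑-allFin-δ : ∀ (i : Fin n) (c : Fin n → ℕ) →
             ∑ (λ j → if ⌊ j ≟F i ⌋ then c j else 0) (allFin n) ≡ c i
∑-allFin-δ i c = trans (∑-allFin-single i λ j j≢i → if-false (⌊≟⌋-false j≢i))
                       (if-true (⌊≟⌋-true {i = i} refl))

module Merge {x : Raw n} (vx : Valid x) {a b : Fin n} (u : Fin 2)
             (fa : fn x a ≡ a) (fb : fn x b ≡ b) (a<b : a Fin.< b) where

  private x' = merge x a b u

  a≢b : a ≢ b
  a≢b = Finₚ.<⇒≢ a<b

  fn'a : fn x' a ≡ a
  fn'a = trans (fn-merge-≢ x a b u (λ p → a≢b (trans (sym fa) p))) fa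

  fn'b : fn x' b ≡ a
  fn'b = fn-merge-≡ x a b u fb

  min'⇒ : ∀ {i} → fn x' i ≡ i → fn x i ≡ i × i ≢ b
  min'⇒ {i} p with fn x i ≟F b
  ... | no q  = trans (sym (fn-merge-≢ x a b u q)) p ,
                λ { refl → a≢b (trans (sym fn'b) p) }
  ... | yes q = case trans (sym p) (fn-merge-≡ x a b u q) of λ
                  { refl → contradiction (trans (sym fa) q) a≢b }

  min'⇐ : ∀ {i} → fn x i ≡ i → i ≢ b → fn x' i ≡ i
  min'⇐ p q = trans (fn-merge-≢ x a b u (q ∘ trans (sym p))) p

  isMin-merge : ∀ i → χ (isMin x i) ≡ χ (isMin x' i) + (if ⌊ i ≟F b ⌋ then 1 else 0)
  isMin-merge i with i ≟F b
  ... | yes refl = trans (cong χ (⌊≟⌋-true fb))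
                     (cong (λ z → χ z + 1) (sym (⌊≟⌋-false (a≢b ∘ trans (sym fn'b)))))
  ... | no i≢b = trans (cong χ (⌊≟⌋-iff (λ p → min'⇐ p i≢b) (proj₁ ∘ min'⇒)))
                       (sym (ℕₚ.+-identityʳ _))

  minsIn-merge : ∀ c → minsIn c x ≡ minsIn c x' + χ (c b)
  minsIn-merge c = begin
    minsIn c x
      ≡⟨ ∑-cong (allFin n) (λ {i} _ → trans (cong (λ z → if c i then z else 0) (isMin-merge i))
                               (trans (if-∙ (c i)) (cong ((if c i then χ (isMin x' i) else 0) +_) (swap-if i (c i))))) ⟩
    ∑ (λ i → (if c i then χ (isMin x' i) else 0) + (if ⌊ i ≟F b ⌋ then χ (c i) else 0)) (allFin n)
      ≡⟨ ∑-∙ _ _ (allFin n) ⟩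
    minsIn c x' + ∑ (λ i → if ⌊ i ≟F b ⌋ then χ (c i) else 0) (allFin n)
      ≡⟨ cong (minsIn c x' +_) (∑-allFin-δ b (χ ∘ c)) ⟩
    minsIn c x' + χ (c b) ∎
    where
    open ≡-Reasoning
    swap-if : ∀ i t → (if t then (if ⌊ i ≟F b ⌋ then 1 else 0) else 0)
                    ≡ (if ⌊ i ≟F b ⌋ then χ t else 0)
    swap-if i t with ⌊ i ≟F b ⌋ | t
    ... | true  | true  = refl
    ... | true  | false = refl
    ... | false | true  = refl
    ... | false | false = refl

  -- Both sides are moved so that no subtraction occurs.
  wt-balance : ∀ i → wt x' i + (if ⌊ i ≟F b ⌋ then wt x b else 0)
                   ≡ wt x i + (if ⌊ i ≟F a ⌋ then wt x b + toℕ u else 0)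
  wt-balance i with i ≟F a
  ... | yes refl rewrite ⌊≟⌋-false a≢b =
    trans (ℕₚ.+-identityʳ _) (trans (wt-merge-a x a b u refl) (ℕₚ.+-assoc (wt x a) _ _))
  ... | no i≢a with i ≟F b
  ...   | yes refl = trans (cong (_+ wt x b) (wt-merge-b x a b u i≢a refl)) (sym (ℕₚ.+-identityʳ _))
  ...   | no i≢b   = cong (_+ 0) (wt-merge-≢ x a b u i≢a i≢b)

  -- The weight at `b` moves to `a`. When `c` contains both points or neither, the sum does not see
  -- this move and only the new bit can change it.
  weightIn-merge : ∀ c → c a ≡ c b →
                   weightIn c x' ≡ weightIn c x + (if c b then toℕ u else 0)
  weightIn-merge c ca≡cb = ℕₚ.+-cancelʳ-≡ (if c b then wt x b else 0) _ _ (begin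
    weightIn c x' + (if c b then wt x b else 0)
      ≡⟨ cong (weightIn c x' +_) (∑-allFin-δ b (λ i → if c i then wt x b else 0)) ⟨
    weightIn c x' + ∑ (λ i → if ⌊ i ≟F b ⌋ then (if c i then wt x b else 0) else 0) (allFin n)
      ≡⟨ ∑-∙ _ _ (allFin n) ⟨
    ∑ (λ i → (if c i then wt x' i else 0) + (if ⌊ i ≟F b ⌋ then (if c i then wt x b else 0) else 0)) (allFin n)
      ≡⟨ ∑-cong (allFin n) (λ {i} _ → pointwise i (c i)) ⟩
    ∑ (λ i → (if c i then wt x i else 0) + (if ⌊ i ≟F a ⌋ then (if c i then wt x b + toℕ u else 0) else 0)) (allFin n)
      ≡⟨ ∑-∙ _ _ (allFin n) ⟩
    weightIn c x + ∑ (λ i → if ⌊ i ≟F a ⌋ then (if c i then wt x b + toℕ u else 0) else 0) (allFin n)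
      ≡⟨ cong (weightIn c x +_) (∑-allFin-δ a (λ i → if c i then wt x b + toℕ u else 0)) ⟩
    weightIn c x + (if c a then wt x b + toℕ u else 0)
      ≡⟨ cong (λ z → weightIn c x + (if z then wt x b + toℕ u else 0)) ca≡cb ⟩
    weightIn c x + (if c b then wt x b + toℕ u else 0)
      ≡⟨ cong (weightIn c x +_) (trans (if-∙ (c b)) (ℕₚ.+-comm (if c b then wt x b else 0) _)) ⟩
    weightIn c x + ((if c b then toℕ u else 0) + (if c b then wt x b else 0))
      ≡⟨ ℕₚ.+-assoc (weightIn c x) _ _ ⟨
    weightIn c x + (if c b then toℕ u else 0) + (if c b then wt x b else 0) ∎)
    where
    open ≡-Reasoning
    pointwise : ∀ i t →
      (if t then wt x' i else 0) + (if ⌊ i ≟F b ⌋ then (if t then wt x b else 0) else 0)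
      ≡ (if t then wt x i else 0) + (if ⌊ i ≟F a ⌋ then (if t then wt x b + toℕ u else 0) else 0)
    pointwise i true  = wt-balance i
    pointwise i false with ⌊ i ≟F a ⌋ | ⌊ i ≟F b ⌋
    ... | true  | true  = refl
    ... | true  | false = refl
    ... | false | true  = refl
    ... | false | false = refl

  blockSize-merge-a : blockSize x' a ≡ blockSize x a + blockSize x b
  blockSize-merge-a = begin
    blockSize x' a ≡⟨ blockSize-∑ x' a ⟩
    ∑ (λ j → χ ⌊ fn x' j ≟F a ⌋) (allFin n) ≡⟨ ∑-cong (allFin n) (λ {j} _ → pointwise j) ⟩
    ∑ (λ j → χ ⌊ fn x j ≟F a ⌋ + χ ⌊ fn x j ≟F b ⌋) (allFin n) ≡⟨ ∑-∙ _ _ (allFin n) ⟩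
    ∑ (λ j → χ ⌊ fn x j ≟F a ⌋) (allFin n) + ∑ (λ j → χ ⌊ fn x j ≟F b ⌋) (allFin n)
      ≡⟨ cong₂ _+_ (blockSize-∑ x a) (blockSize-∑ x b) ⟨
    blockSize x a + blockSize x b ∎
    where
    open ≡-Reasoning
    pointwise : ∀ j → χ ⌊ fn x' j ≟F a ⌋ ≡ χ ⌊ fn x j ≟F a ⌋ + χ ⌊ fn x j ≟F b ⌋
    pointwise j with fn x j ≟F b
    ... | yes q = trans (cong χ (⌊≟⌋-true (fn-merge-≡ x a b u q)))
                    (cong (λ z → χ z + 1) (sym (⌊≟⌋-false λ p → a≢b (trans (sym p) q))))
    ... | no q  = trans (cong (λ z → χ ⌊ z ≟F a ⌋) (fn-merge-≢ x a b u q)) (sym (ℕₚ.+-identityʳ _))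

  blockSize-merge-≢ : ∀ {i} → i ≢ a → i ≢ b → blockSize x' i ≡ blockSize x i
  blockSize-merge-≢ {i} i≢a i≢b =
    trans (blockSize-∑ x' i) (trans (∑-cong (allFin n) (λ {j} _ → pointwise j)) (sym (blockSize-∑ x i)))
    where
    pointwise : ∀ j → χ ⌊ fn x' j ≟F i ⌋ ≡ χ ⌊ fn x j ≟F i ⌋
    pointwise j with fn x j ≟F b
    ... | yes q = cong χ (trans (⌊≟⌋-false λ p → i≢a (trans (sym p) (fn-merge-≡ x a b u q)))
                                (sym (⌊≟⌋-false λ p → i≢b (trans (sym p) q))))
    ... | no q  = cong (λ z → χ ⌊ z ≟F i ⌋) (fn-merge-≢ x a b u q)

  merge-valid : Valid x'
  merge-valid .idem i with fn x i ≟F b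
  ... | yes q = subst (λ z → fn x' z ≡ z) (sym (fn-merge-≡ x a b u q)) fn'a
  ... | no q  = subst (λ z → fn x' z ≡ z) (sym (fn-merge-≢ x a b u q)) (min'⇐ (idem vx i) q)
  merge-valid .low i with fn x i ≟F b
  ... | yes q = subst (Fin._≤ i) (sym (fn-merge-≡ x a b u q))
                  (ℕₚ.≤-trans (ℕₚ.<⇒≤ a<b) (subst (Fin._≤ i) q (low vx i)))
  ... | no q  = subst (Fin._≤ i) (sym (fn-merge-≢ x a b u q)) (low vx i)
  merge-valid .wt< i p with i ≟F a
  -- Each of the two strict bounds leaves one unit: one pays for the bit `u`, the other keeps the
  -- new bound strict.
  ... | yes refl = subst₂ _<_ (sym (wt-merge-a x a b u refl)) (sym blockSize-merge-a)
                     (ℕₚ.≤-trans (s≤s (ℕₚ.≤-trans (ℕₚ.+-monoʳ-≤ _ (ℕₚ.≤-pred (Finₚ.toℕ<n u)))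
                                                  (ℕₚ.≤-reflexive (ℕₚ.+-comm _ 1))))
                       (ℕₚ.≤-trans (ℕₚ.≤-reflexive (sym (cong suc (ℕₚ.+-suc (wt x a) (wt x b)))))
                                   (ℕₚ.+-mono-≤ (wt< vx a fa) (wt< vx b fb))))
  ... | no i≢a = let (fi , i≢b) = min'⇒ p in
                 subst₂ _<_ (sym (wt-merge-≢ x a b u i≢a i≢b)) (sym (blockSize-merge-≢ i≢a i≢b))
                   (wt< vx i fi)
  merge-valid .wt0 i p with i ≟F b
  ... | yes refl = wt-merge-b x a b u (≢-sym a≢b) refl
  ... | no i≢b   = trans (wt-merge-≢ x a b u (λ { refl → p fn'a }) i≢b)
                         (wt0 vx i (λ q → p (min'⇐ q i≢b)))

⋆-valid : {x : Raw n} (ℓ : Label n) → Valid x → Mergeable x ℓ → Valid (x ⋆ ℓ)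
⋆-valid (a , b , u) vx (fa , fb , a<b) = Merge.merge-valid vx u fa fb a<b

-- The number of blocks. It drops by one along every cover, so it excludes cycles and bounds the
-- fuel of the recursions along chains.
#mins : Raw n → ℕ
#mins = minsIn λ _ → true

#mins-⋆ : {x : Raw n} (ℓ : Label n) → Valid x → Mergeable x ℓ → #mins x ≡ suc (#mins (x ⋆ ℓ))
#mins-⋆ (a , b , u) vx (fa , fb , a<b) =
  trans (Merge.minsIn-merge vx u fa fb a<b _) (ℕₚ.+-comm _ 1)

-- Refinement with weight bounds, and its relation to chains

module _ {n : ℕ} where
  open ΠwLabeling n public

inClass : Raw n → Fin n → Fin n → Bool
inClass y r i = ⌊ fn y i ≟F r ⌋

-- A nonempty class of `y` contains one minimum of `y`, so comparing weight plus number of minima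
-- expresses the upper bound "sum plus k - 1" without subtraction.
slack : (Fin n → Bool) → Raw n → ℕ
slack c x = weightIn c x + minsIn c x

-- A block of y made of k blocks of x has weight between the sum of their
-- weights and that sum plus k - 1.
record _⊑_ (x y : Raw n) : Set where
  field
    coarse  : ∀ i → fn y (fn x i) ≡ fn y i
    weight≤ : ∀ r → weightIn (inClass y r) x ≤ weightIn (inClass y r) y
    slack≥  : ∀ r → slack (inClass y r) y ≤ slack (inClass y r) x

open _⊑_

⊑-refl : {x : Raw n} → Valid x → x ⊑ x
⊑-refl vx = record { coarse = idem vx ; weight≤ = λ _ → ℕₚ.≤-refl ; slack≥ = λ _ → ℕₚ.≤-refl }

if-bit≤χ : ∀ t (u : Fin 2) → (if t then toℕ u else 0) ≤ χ t
if-bit≤χ false u = z≤n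
if-bit≤χ true  u = ℕₚ.≤-pred (Finₚ.toℕ<n u)

module _ {x y : Raw n} (vx : Valid x) {a b : Fin n} (u : Fin 2)
         (mg : Mergeable x (a , b , u)) (x'⊑y : merge x a b u ⊑ y) where

  private
    x' = merge x a b u
    module M = Merge vx u (proj₁ mg) (proj₁ (proj₂ mg)) (proj₂ (proj₂ mg))

  merged-same-class : fn y a ≡ fn y b
  merged-same-class = trans (cong (fn y) (sym M.fn'b)) (coarse x'⊑y b)

  private
    same : ∀ r → inClass y r a ≡ inClass y r b
    same r = cong (λ z → ⌊ z ≟F r ⌋) merged-same-class

  slack-merge : ∀ r → slack (inClass y r) x' + χ (inClass y r b)
                    ≡ slack (inClass y r) x + (if inClass y r b then toℕ u else 0)
  slack-merge r = begin
    weightIn c x' + minsIn c x' + χ (c b)   ≡⟨ ℕₚ.+-assoc (weightIn c x') _ _ ⟩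
    weightIn c x' + (minsIn c x' + χ (c b)) ≡⟨ cong₂ _+_ (M.weightIn-merge c (same r)) (sym (M.minsIn-merge c)) ⟩
    weightIn c x + e + minsIn c x           ≡⟨ ℕₚ.+-assoc (weightIn c x) _ _ ⟩
    weightIn c x + (e + minsIn c x)         ≡⟨ cong (weightIn c x +_) (ℕₚ.+-comm e _) ⟩
    weightIn c x + (minsIn c x + e)         ≡⟨ ℕₚ.+-assoc (weightIn c x) _ _ ⟨
    slack c x + e ∎
    where
    open ≡-Reasoning
    c = inClass y r
    e = if c b then toℕ u else 0

  slack-merge-≤ : ∀ r → slack (inClass y r) x' ≤ slack (inClass y r) x
  slack-merge-≤ r = ℕₚ.+-cancelʳ-≤ (χ (inClass y r b)) _ _
    (ℕₚ.≤-trans (ℕₚ.≤-reflexive (slack-merge r))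
                (ℕₚ.+-monoʳ-≤ (slack (inClass y r) x) (if-bit≤χ (inClass y r b) u)))

  -- Going back from the merge to `x`, the weight in a class of `y` can only drop and the slack can
  -- only grow, so both bounds survive.
  ⊑-unmerge : x ⊑ y
  ⊑-unmerge .coarse i = begin
    fn y (fn x i)         ≡⟨ coarse x'⊑y (fn x i) ⟨
    fn y (fn x' (fn x i)) ≡⟨ cong (fn y) x'x≡x' ⟩
    fn y (fn x' i)        ≡⟨ coarse x'⊑y i ⟩
    fn y i ∎
    where
    open ≡-Reasoning
    x'x≡x' : fn x' (fn x i) ≡ fn x' i
    x'x≡x' = trans (fn-merge x a b u (fn x i))
               (trans (cong (λ z → if ⌊ z ≟F b ⌋ then a else z) (idem vx i))
                      (sym (fn-merge x a b u i)))
  ⊑-unmerge .weight≤ r =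
    ℕₚ.≤-trans (ℕₚ.m≤m+n _ _)
      (ℕₚ.≤-trans (ℕₚ.≤-reflexive (sym (M.weightIn-merge (inClass y r) (same r))))
                  (weight≤ x'⊑y r))
  ⊑-unmerge .slack≥ r = ℕₚ.≤-trans (slack≥ x'⊑y r) (slack-merge-≤ r)

chain-valid : {x y : Raw n} → Valid x → Chain x y → Valid y
chain-valid vx done = vx
chain-valid {x = x} vx (step {ℓ = ℓ} cov c) with refl ← proj₂ (cover⇒ x ℓ cov) =
  chain-valid (⋆-valid ℓ vx (proj₁ (cover⇒ x ℓ cov))) c

chain⇒⊑ : {x y : Raw n} → Valid x → Chain x y → x ⊑ y
chain⇒⊑ vx done = ⊑-refl vx
chain⇒⊑ {x = x} vx (step {ℓ = ℓ} cov c) with mg , refl ← cover⇒ x ℓ cov =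
  ⊑-unmerge vx _ mg (chain⇒⊑ (⋆-valid ℓ vx mg) c)

chain-#mins : {x y : Raw n} → Valid x → Chain x y → #mins y ≤ #mins x
chain-#mins vx done = ℕₚ.≤-refl
chain-#mins {x = x} vx (step {ℓ = ℓ} cov c) with mg , refl ← cover⇒ x ℓ cov =
  ℕₚ.≤-trans (chain-#mins (⋆-valid ℓ vx mg) c)
    (ℕₚ.≤-trans (ℕₚ.n≤1+n _) (ℕₚ.≤-reflexive (sym (#mins-⋆ ℓ vx mg))))

acyclic : {x : Raw n} (ℓ : Label n) → Valid x → Mergeable x ℓ → ¬ Chain (x ⋆ ℓ) x
acyclic ℓ vx mg c = ℕₚ.<-irrefl refl
  (ℕₚ.≤-trans (ℕₚ.≤-reflexive (sym (#mins-⋆ ℓ vx mg))) (chain-#mins (⋆-valid ℓ vx mg) c))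

labels⇒elems : {x y z : Raw n} (c₁ : Chain x y) (c₂ : Chain x z) →
               labels c₁ ≡ labels c₂ → elems c₁ ≡ elems c₂
labels⇒elems done done _ = refl
labels⇒elems done (step _ _) ()
labels⇒elems (step _ _) done ()
labels⇒elems {x = x} (step {ℓ = ℓ} cov₁ c₁) (step cov₂ c₂) eq
  with refl , eq' ← Listₚ.∷-injective eq
  with refl ← proj₂ (cover⇒ x ℓ cov₁) | refl ← proj₂ (cover⇒ x ℓ cov₂)
  = cong (_ ∷_) (labels⇒elems c₁ c₂ eq')

-- Extremal labels

module _ {A : Set} {P : A → Set} (P? : Decidable P) {_≲_ : A → A → Set}
         (≲-total : ∀ a b → a ≲ b ⊎ b ≲ a) (≲-trans : Transitive _≲_) where

  private
    ≲-refl : ∀ {a} → a ≲ a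
    ≲-refl {a} with ≲-total a a
    ... | inj₁ r = r
    ... | inj₂ r = r

  extremum : (L : List A) →
             (∃ λ m → P m × (∀ {a} → a ∈ L → P a → m ≲ a)) ⊎ (∀ {a} → a ∈ L → ¬ P a)
  extremum [] = inj₂ λ ()
  extremum (a ∷ L) with P? a | extremum L
  ... | no ¬p | inj₂ none = inj₂ λ { (here refl) → ¬p ; (there a∈L) → none a∈L }
  ... | no ¬p | inj₁ (m , pm , least) =
    inj₁ (m , pm , λ { (here refl) p → contradiction p ¬p ; (there a∈L) → least a∈L })
  ... | yes p | inj₂ none =
    inj₁ (a , p , λ { (here refl) _ → ≲-refl ; (there b∈L) pb → contradiction pb (none b∈L) })
  ... | yes p | inj₁ (m , pm , least) with ≲-total a m
  ...   | inj₂ m≲a = inj₁ (m , pm , λ { (here refl) _ → m≲a ; (there b∈L) → least b∈L })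
  ...   | inj₁ a≲m =
    inj₁ (a , p , λ { (here refl) _ → ≲-refl ; (there b∈L) pb → ≲-trans a≲m (least b∈L pb) })

_≤lex_ : Fin n × Fin n → Fin n × Fin n → Set
(a , b) ≤lex (a' , b') = a Fin.< a' ⊎ (a ≡ a' × b Fin.≤ b')

≤lex-trans : Transitive (_≤lex_ {n})
≤lex-trans (inj₁ p)          (inj₁ q)          = inj₁ (ℕₚ.<-trans p q)
≤lex-trans (inj₁ p)          (inj₂ (refl , _)) = inj₁ p
≤lex-trans (inj₂ (refl , _)) (inj₁ q)          = inj₁ q
≤lex-trans (inj₂ (refl , p)) (inj₂ (refl , q)) = inj₂ (refl , ℕₚ.≤-trans p q)

≤lex-total : (p q : Fin n × Fin n) → p ≤lex q ⊎ q ≤lex p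
≤lex-total (a , b) (a' , b') with Finₚ.<-cmp a a'
... | tri< a<a' _ _ = inj₁ (inj₁ a<a')
... | tri> _ _ a>a' = inj₂ (inj₁ a>a')
... | tri≈ _ refl _ with Finₚ.≤-total b b'
...   | inj₁ b≤b' = inj₁ (inj₂ (refl , b≤b'))
...   | inj₂ b'≤b = inj₂ (inj₂ (refl , b'≤b))

≤lex-antisym : {p q : Fin n × Fin n} → p ≤lex q → q ≤lex p → p ≡ q
≤lex-antisym (inj₁ p)          (inj₁ q)          = contradiction q (ℕₚ.<-asym p)
≤lex-antisym (inj₁ p)          (inj₂ (refl , _)) = contradiction p (ℕₚ.<-irrefl refl)
≤lex-antisym (inj₂ (refl , _)) (inj₁ q)          = contradiction q (ℕₚ.<-irrefl refl)
≤lex-antisym (inj₂ (refl , p)) (inj₂ (_ , q))    = cong (_ ,_) (Finₚ.≤-antisym p q)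

≤lex⇒≤ : {a a' b b' : Fin n} → (a , b) ≤lex (a' , b') → a Fin.≤ a'
≤lex⇒≤ (inj₁ a<a')       = ℕₚ.<⇒≤ a<a'
≤lex⇒≤ (inj₂ (refl , _)) = ℕₚ.≤-refl

≤Λ⇒≤lex : {a a' b b' : Fin n} {u u' : Fin 2} → (a , b , u) ≤Λ (a' , b' , u') → (a , b) ≤lex (a' , b')
≤Λ⇒≤lex (inj₁ p)           = inj₁ p
≤Λ⇒≤lex (inj₂ (p , q , _)) = inj₂ (p , q)

-- These are the minima that a chain from `x` to `y` has to absorb, each exactly once, as the second
-- entry of a label.
Pending : Raw n → Raw n → Fin n → Set
Pending x y b = fn x b ≡ b × fn y b ≢ b

pending? : (x y : Raw n) → Decidable (Pending x y)
pending? x y b = (fn x b ≟F b) ×-dec ¬? (fn y b ≟F b)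

bit0 bit1 : Fin 2
bit0 = Fin.zero
bit1 = Fin.suc Fin.zero

-- The difference of the two slacks is the number of 0-merges still owed in the class of `a`; bit 0
-- is prescribed while it is positive.
Tight : Raw n → Raw n → Fin n → Fin 2 → Set
Tight x y a Fin.zero    = slack (inClass y a) y < slack (inClass y a) x
Tight x y a (Fin.suc _) = slack (inClass y a) x ≡ slack (inClass y a) y

tight-exists : {x y : Raw n} → x ⊑ y → ∀ a → ∃ (Tight x y a)
tight-exists {x = x} {y} x⊑y a with slack (inClass y a) x ℕ.≟ slack (inClass y a) y
... | yes p = bit1 , p
... | no ¬p = bit0 , ℕₚ.≤∧≢⇒< (slack≥ x⊑y a) (¬p ∘ sym)

tight-unique : {x y : Raw n} {a : Fin n} (u v : Fin 2) → Tight x y a u → Tight x y a v → u ≡ v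
tight-unique Fin.zero           Fin.zero           _ _ = refl
tight-unique (Fin.suc Fin.zero) (Fin.suc Fin.zero) _ _ = refl
tight-unique Fin.zero           (Fin.suc _)        p q = contradiction p (ℕₚ.<-irrefl (sym q))
tight-unique (Fin.suc _)        Fin.zero           p q = contradiction q (ℕₚ.<-irrefl (sym p))

-- A label (a , b)^u out of x towards y with (a , b) extremal for ◃; u records
-- whether every remaining merge inside the block of a has to be a 1-merge.
Lead : (Fin n × Fin n → Fin n × Fin n → Set) → Raw n → Raw n → Label n → Set
Lead _◃_ x y (a , b , u) =
  Pending x y b × fn y b ≡ a × (∀ b' → Pending x y b' → (a , b) ◃ (fn y b' , b')) × Tight x y a u

-- A minimum `i` of `y` satisfies `i = fn y (fn x i) ≤ fn x i ≤ i`, so it is a minimum of `x` as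
-- well.
minsIn-anti : {x y : Raw n} → Valid x → Valid y → (∀ i → fn y (fn x i) ≡ fn y i) →
              ∀ c → minsIn c y ≤ minsIn c x
minsIn-anti {n} {x} {y} vx vy coarse c = ∑-mono-≤ (allFin n) λ {i} _ → pointwise i (c i)
  where
  pointwise : ∀ i t → (if t then χ (isMin y i) else 0) ≤ (if t then χ (isMin x i) else 0)
  pointwise i false = z≤n
  pointwise i true with fn y i ≟F i
  ... | no _  = z≤n
  ... | yes p = ℕₚ.≤-reflexive (cong χ (sym (⌊≟⌋-true (Finₚ.≤-antisym (low vx i)
    (subst (Fin._≤ fn x i) (trans (coarse i) p) (low vy (fn x i)))))))

module _ {x y : Raw n} (vx : Valid x) (vy : Valid y) (x⊑y : x ⊑ y)
         {a b : Fin n} (pend : Pending x y b) (yb : fn y b ≡ a) where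

  private
    ya : fn y a ≡ a
    ya = trans (cong (fn y) (sym yb)) (trans (idem vy b) yb)

  class-mergeable : (u : Fin 2) → Mergeable x (a , b , u)
  class-mergeable u = fa , proj₁ pend , Finₚ.≤∧≢⇒< (subst (Fin._≤ b) yb (low vy b)) (λ a≡b → proj₂ pend (trans yb a≡b))
    where
    fa : fn x a ≡ a
    fa = Finₚ.≤-antisym (low vx a)
           (subst (Fin._≤ fn x a) (trans (coarse x⊑y a) ya) (low vy (fn x a)))

  -- Bit 0 threatens only the slack bound, and strictness leaves the unit that is lost. Bit 1
  -- threatens only the weight bound; at equal slacks `x` has one minimum more than the merge and
  -- hence more than `y` in this class, so its weight is smaller by at least one.
  tight-merge-⊑ : (u : Fin 2) → Tight x y a u → merge x a b u ⊑ y
  tight-merge-⊑ u tight = record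
    { coarse  = coarse'
    ; weight≤ = λ r → ℕₚ.≤-trans (ℕₚ.≤-reflexive (M.weightIn-merge (inClass y r) (same r))) (w≤ r)
    ; slack≥  = s≥ }
    where
    x' = merge x a b u
    mg = class-mergeable u
    module M = Merge vx u (proj₁ mg) (proj₁ (proj₂ mg)) (proj₂ (proj₂ mg))
    same : ∀ r → inClass y r a ≡ inClass y r b
    same r = cong (λ z → ⌊ z ≟F r ⌋) (trans ya (sym yb))
    coarse' : ∀ i → fn y (fn x' i) ≡ fn y i
    coarse' i with fn x i ≟F b
    ... | no q  = trans (cong (fn y) (fn-merge-≢ x a b u q)) (coarse x⊑y i)
    ... | yes q = trans (cong (fn y) (fn-merge-≡ x a b u q))
                    (trans ya (trans (sym yb) (trans (cong (fn y) (sym q)) (coarse x⊑y i))))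
    K≤ : ∀ r → minsIn (inClass y r) y ≤ minsIn (inClass y r) x'
    K≤ r = minsIn-anti M.merge-valid vy coarse' (inClass y r)
    module _ (r : Fin n) where
      c  = inClass y r
      Wx = weightIn c x
      Wy = weightIn c y
      Kx = minsIn c x
      Ky = minsIn c y
      Kx' = minsIn c x'
    outside : ∀ {r} → a ≢ r → inClass y r b ≡ false
    outside a≢r = ⌊≟⌋-false λ p → a≢r (trans (sym yb) p)
    inside : inClass y a b ≡ true
    inside = ⌊≟⌋-true yb
    Kx≡ : Kx a ≡ suc (Kx' a)
    Kx≡ = trans (M.minsIn-merge (c a)) (trans (cong (λ t → Kx' a + χ t) inside) (ℕₚ.+-comm _ 1))
    w≤a : ∀ v → Tight x y a v → Wx a + toℕ v ≤ Wy a
    w≤a Fin.zero _ = subst (_≤ Wy a) (sym (ℕₚ.+-identityʳ (Wx a))) (weight≤ x⊑y a)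
    w≤a (Fin.suc Fin.zero) eq = ℕₚ.+-cancelʳ-≤ (Kx' a) _ _ (begin
      Wx a + 1 + Kx' a   ≡⟨ ℕₚ.+-assoc (Wx a) 1 _ ⟩
      Wx a + suc (Kx' a) ≡⟨ cong (Wx a +_) Kx≡ ⟨
      Wx a + Kx a        ≡⟨ eq ⟩
      Wy a + Ky a        ≤⟨ ℕₚ.+-monoʳ-≤ (Wy a) (K≤ a) ⟩
      Wy a + Kx' a       ∎)
      where open ℕₚ.≤-Reasoning
    w≤ : ∀ r → Wx r + (if inClass y r b then toℕ u else 0) ≤ Wy r
    w≤ r with a ≟F r
    ... | yes refl = subst (λ t → Wx a + (if t then toℕ u else 0) ≤ Wy a) (sym inside) (w≤a u tight)
    ... | no a≢r   = subst (λ t → Wx r + (if t then toℕ u else 0) ≤ Wy r) (sym (outside a≢r))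
                       (subst (_≤ Wy r) (sym (ℕₚ.+-identityʳ (Wx r))) (weight≤ x⊑y r))
    s≥a : ∀ v → Tight x y a v → slack (c a) y ≤ Wx a + toℕ v + Kx' a
    s≥a Fin.zero lt = ℕₚ.≤-pred (ℕₚ.≤-trans lt (ℕₚ.≤-reflexive
      (trans (cong (Wx a +_) Kx≡) (trans (ℕₚ.+-suc (Wx a) _)
        (cong (λ z → suc (z + Kx' a)) (sym (ℕₚ.+-identityʳ (Wx a))))))))
    s≥a (Fin.suc Fin.zero) eq = ℕₚ.≤-reflexive (trans (sym eq)
      (trans (cong (Wx a +_) Kx≡) (sym (ℕₚ.+-assoc (Wx a) 1 _))))
    s≥ : ∀ r → slack (inClass y r) y ≤ slack (inClass y r) x'
    s≥ r with a ≟F r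
    ... | yes refl = subst (λ z → slack (c a) y ≤ z + Kx' a)
                       (sym (trans (M.weightIn-merge (c a) (same a))
                                   (cong (λ t → Wx a + (if t then toℕ u else 0)) inside)))
                       (s≥a u tight)
    ... | no a≢r   = subst (slack (inClass y r) y ≤_)
                       (cong₂ _+_
                         (sym (trans (M.weightIn-merge (c r) (same r))
                           (trans (cong (λ t → Wx r + (if t then toℕ u else 0)) (outside a≢r)) (ℕₚ.+-identityʳ _))))
                         (trans (M.minsIn-merge (c r))
                           (trans (cong (λ t → Kx' r + χ t) (outside a≢r)) (ℕₚ.+-identityʳ _))))
                       (slack≥ x⊑y r)

weightIn-class : {y z : Raw n} → Valid z → (∀ i → fn z i ≡ fn y i) → ∀ {i} → fn y i ≡ i →
                 weightIn (inClass y i) z ≡ wt z i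
weightIn-class {y = y} {z} vz z≗y {i} p = trans (∑-allFin-single i off) (if-true (⌊≟⌋-true p))
  where
  off : ∀ j → j ≢ i → (if inClass y i j then wt z j else 0) ≡ 0
  off j j≢i with fn y j ≟F i
  ... | no _  = refl
  ... | yes q = wt0 vz j λ r → j≢i (trans (sym r) (trans (z≗y j) q))

-- With nothing left to absorb the blocks agree. Then each class has the same number of minima on
-- both sides, and the two bounds pinch its weight.
no-pending⇒≡ : {x y : Raw n} → Valid x → Valid y → x ⊑ y → (∀ b → ¬ Pending x y b) → x ≡ y
no-pending⇒≡ {n} {x} {y} vx vy x⊑y none = raw-ext fn≡ wt≡
  where
  fn≡ : ∀ i → fn x i ≡ fn y i
  fn≡ i = trans (sym (decidable-stable (fn y (fn x i) ≟F fn x i) λ q → none (fn x i) (idem vx i , q)))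
                (coarse x⊑y i)
  wt≡ : ∀ i → wt x i ≡ wt y i
  wt≡ i with fn y i ≟F i
  ... | no ¬p = trans (wt0 vx i (¬p ∘ trans (sym (fn≡ i)))) (sym (wt0 vy i ¬p))
  ... | yes p = begin
    wt x i ≡⟨ weightIn-class {y = y} vx fn≡ p ⟨
    weightIn (inClass y i) x ≡⟨ ℕₚ.≤-antisym (weight≤ x⊑y i) wy≤wx ⟩
    weightIn (inClass y i) y ≡⟨ weightIn-class {y = y} vy (λ _ → refl) p ⟩
    wt y i ∎
    where
    open ≡-Reasoning
    minsIn≡ : minsIn (inClass y i) y ≡ minsIn (inClass y i) x
    minsIn≡ = ∑-cong (allFin n) λ {j} _ →
      cong (λ k → if inClass y i j then χ ⌊ k ≟F j ⌋ else 0) (sym (fn≡ j))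
    wy≤wx : weightIn (inClass y i) y ≤ weightIn (inClass y i) x
    wy≤wx = ℕₚ.+-cancelʳ-≤ (minsIn (inClass y i) x) _ _
      (subst (λ k → weightIn (inClass y i) y + k ≤ slack (inClass y i) x) minsIn≡ (slack≥ x⊑y i))

-- A greedy construction shared by both kinds of chains: with `_≤lex_` it takes the smallest pending
-- pair and yields increasing chains, with the flipped order the largest pair and ascent-free
-- chains.
module BuildChain
  {_◃_ : Fin n × Fin n → Fin n × Fin n → Set}
  (◃-total : ∀ p q → p ◃ q ⊎ q ◃ p) (◃-trans : Transitive _◃_) {y : Raw n} (vy : Valid y)
  {R : Label n → Label n → Set}
  (compatible : ∀ {x ℓ ℓ'} → Valid x → Mergeable x ℓ → (x ⋆ ℓ) ⊑ y →
                Lead _◃_ x y ℓ → Lead _◃_ (x ⋆ ℓ) y ℓ' → R ℓ ℓ') where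

  lead-or-≡ : ∀ {x} → Valid x → x ⊑ y → (∃ λ ℓ → Lead _◃_ x y ℓ × Mergeable x ℓ × (x ⋆ ℓ) ⊑ y) ⊎ (x ≡ y)
  lead-or-≡ {x} vx x⊑y
    with extremum (pending? x y) {λ b b' → (fn y b , b) ◃ (fn y b' , b')}
                  (λ b b' → ◃-total _ _) ◃-trans (allFin n)
  ... | inj₂ none = inj₂ (no-pending⇒≡ vx vy x⊑y λ b → none (∈-allFin b))
  ... | inj₁ (b , pend , least) with u , tight ← tight-exists x⊑y (fn y b) =
    inj₁ ((fn y b , b , u) , (pend , refl , (λ b' → least (∈-allFin b')) , tight) ,
          class-mergeable vx vy x⊑y pend refl u , tight-merge-⊑ vx vy x⊑y pend refl u tight)

  -- The `Lead` property of the first label is returned too, since it is what `compatible` needs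
  -- when another label is put in front.
  build : ∀ k {x} → #mins x ≤ k → Valid x → x ⊑ y →
          Σ (Chain x y) λ c → Linked R (labels c) × (∀ {ℓ ls} → labels c ≡ ℓ ∷ ls → Lead _◃_ x y ℓ)
  build k x≤k vx x⊑y with lead-or-≡ vx x⊑y
  ... | inj₂ refl = done , [] , λ ()
  build zero x≤k vx x⊑y | inj₁ (ℓ , lead , mg , x'⊑y) =
    contradiction (subst (_≤ 0) (#mins-⋆ ℓ vx mg) x≤k) λ ()
  build (suc k) {x} x≤k vx x⊑y | inj₁ (ℓ , lead , mg , x'⊑y)
    with build k (ℕₚ.≤-pred (subst (_≤ suc k) (#mins-⋆ ℓ vx mg) x≤k)) (⋆-valid ℓ vx mg) x'⊑y
  ... | c , lc , head = step (cover⇐ x ℓ mg) c , link c lc head , λ { refl → lead }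
    where
    link : (c : Chain _ y) → Linked R (labels c) →
           (∀ {ℓ' ls} → labels c ≡ ℓ' ∷ ls → Lead _◃_ _ y ℓ') → Linked R (ℓ ∷ labels c)
    link done       _  _    = [-]
    link (step _ c) lc head = compatible vx mg x'⊑y lead (head refl) ∷ lc

-- Consecutive leading labels, and uniqueness of increasing chains

module _ {x y : Raw n} (vx : Valid x) {a b : Fin n} {u : Fin 2}
         (mg : Mergeable x (a , b , u)) where

  private module M = Merge vx u (proj₁ mg) (proj₁ (proj₂ mg)) (proj₂ (proj₂ mg))

  pending-merge⁻ : ∀ {i} → Pending (merge x a b u) y i → Pending x y i × i ≢ b
  pending-merge⁻ (p , q) = let (r , s) = M.min'⇒ p in (r , q) , s

  pending-merge⁺ : ∀ {i} → Pending x y i → i ≢ b → Pending (merge x a b u) y i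
  pending-merge⁺ (p , q) i≢b = M.min'⇐ p i≢b , q

slack-merge-in : {x y : Raw n} (vx : Valid x) {a b : Fin n} (u : Fin 2)
                 (mg : Mergeable x (a , b , u)) → merge x a b u ⊑ y → fn y b ≡ a →
                 slack (inClass y a) (merge x a b u) + 1 ≡ slack (inClass y a) x + toℕ u
slack-merge-in {x = x} {y} vx {a} {b} u mg x'⊑y yb =
  subst (λ t → slack (inClass y a) (merge x a b u) + χ t ≡ slack (inClass y a) x + (if t then toℕ u else 0))
    (⌊≟⌋-true yb) (slack-merge vx u mg x'⊑y a)

-- Whatever is pending after the merge was pending before and is not `b`, so the next pair is
-- larger. In the same block the bits cannot fall from 1 to 0: a 1-merge keeps the slack, so
-- equality with the slack of `y` persists.
first-ascent : {x y : Raw n} {ℓ ℓ' : Label n} → Valid x → Mergeable x ℓ → (x ⋆ ℓ) ⊑ y →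
               Lead _≤lex_ x y ℓ → Lead _≤lex_ (x ⋆ ℓ) y ℓ' → ℓ <Λ ℓ'
first-ascent {x = x} {y} {a , b , u} {a' , b' , u'} vx mg x'⊑y (_ , yb , least , tight) (pend' , refl , _ , tight')
  with pend , b'≢b ← pending-merge⁻ {y = y} vx {u = u} mg pend' with least b' pend
... | inj₁ a<a'          = inj₁ a<a' , λ { refl → b'≢b refl }
... | inj₂ (a≡a' , b≤b') = inj₂ (a≡a' , b≤b' , bits a≡a' u u' mg x'⊑y tight tight') , λ { refl → b'≢b refl }
  where
  bits : a ≡ fn y b' → ∀ u u' → (mg : Mergeable x (a , b , u)) → merge x a b u ⊑ y →
         Tight x y a u → Tight (merge x a b u) y (fn y b') u' → u Fin.≤ u'
  bits p Fin.zero    u' _ _ _ _ = z≤n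
  bits p (Fin.suc Fin.zero) (Fin.suc _) _ _ _ _ = s≤s z≤n
  bits refl (Fin.suc Fin.zero) Fin.zero mg x'⊑y t t' = contradiction t'
    (ℕₚ.<-irrefl (trans (sym t) (sym (ℕₚ.+-cancelʳ-≡ 1 _ _ (slack-merge-in vx bit1 mg x'⊑y yb)))))

-- The next pair is at most the first by maximality; an ascent would make them equal, so that `b`
-- would be absorbed twice.
last-nonascent : {x y : Raw n} {ℓ ℓ' : Label n} → Valid x → Mergeable x ℓ →
                 Lead (flip _≤lex_) x y ℓ → Lead (flip _≤lex_) (x ⋆ ℓ) y ℓ' → ¬ (ℓ <Λ ℓ')
last-nonascent {x = x} {y} {a , b , u} {a' , b' , u'} vx mg (_ , _ , greatest , _) (pend' , refl , _) (ℓ≤ℓ' , _)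
  with pend , b'≢b ← pending-merge⁻ {y = y} vx {u = u} mg pend'
  with ≤lex-antisym (greatest b' pend) (≤Λ⇒≤lex ℓ≤ℓ')
... | refl = b'≢b refl

first-unique : {x y : Raw n} {ℓ ℓ' : Label n} → Lead _≤lex_ x y ℓ → Lead _≤lex_ x y ℓ' → ℓ ≡ ℓ'
first-unique {x = x} {y} {a , b , u} {a' , b' , u'} (p , refl , m , t) (p' , refl , m' , t')
  with refl ← cong proj₂ (≤lex-antisym (m b' p') (m' b p)) =
  cong (λ v → _ , _ , v) (tight-unique {x = x} {y} u u' t t')

-- A 0-merge loses a unit of slack, so strictness comes for free; for a 1-merge equality has to be
-- known after the merge.
tight-of-merge : {x y : Raw n} (vx : Valid x) {a b : Fin n} (u : Fin 2)
                 (mg : Mergeable x (a , b , u)) → merge x a b u ⊑ y → fn y b ≡ a →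
                 (u ≡ bit1 → slack (inClass y a) (merge x a b u) ≡ slack (inClass y a) y) →
                 Tight x y a u
tight-of-merge {x = x} {y} vx {a} {b} Fin.zero mg x'⊑y yb _ = begin-strict
  slack c y                          ≤⟨ slack≥ x'⊑y a ⟩
  slack c (merge x a b bit0)         <⟨ ℕₚ.n<1+n _ ⟩
  suc (slack c (merge x a b bit0))   ≡⟨ ℕₚ.+-comm _ 1 ⟨
  slack c (merge x a b bit0) + 1     ≡⟨ slack-merge-in vx bit0 mg x'⊑y yb ⟩
  slack c x + 0                      ≡⟨ ℕₚ.+-identityʳ _ ⟩
  slack c x                          ∎
  where
  open ℕₚ.≤-Reasoning
  c = inClass y a
tight-of-merge vx (Fin.suc Fin.zero) mg x'⊑y yb eq =
  trans (sym (ℕₚ.+-cancelʳ-≡ 1 _ _ (slack-merge-in vx bit1 mg x'⊑y yb))) (eq refl)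

-- By induction the next label leads after the merge, so its pair is the least one pending there.
-- The ascent puts `(a , b)` below it, and `b` is the only other pending minimum of `x`.
increasing⇒first : {x z y : Raw n} {ℓ : Label n} → Valid x → (cov : WCover x ℓ z) (c : Chain z y) →
                   Increasing (step {x = x} {ℓ = ℓ} cov c) → Lead _≤lex_ x y ℓ
increasing⇒first {n} {x} {ℓ = a , b , u} vx cov c inc with mg , refl ← cover⇒ x (a , b , u) cov = go c inc
  where
  x' = merge x a b u
  module M = Merge vx u (proj₁ mg) (proj₁ (proj₂ mg)) (proj₂ (proj₂ mg))
  vx' = M.merge-valid
  go : ∀ {y} (c : Chain x' y) → Linked _<Λ_ ((a , b , u) ∷ labels c) → Lead _≤lex_ x y (a , b , u)
  go done _ =
    (proj₁ (proj₂ mg) , λ p → M.a≢b (trans (sym M.fn'b) p)) , M.fn'b , least ,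
    tight-of-merge vx u mg (⊑-refl vx') M.fn'b (λ _ → refl)
    where
    least : ∀ b' → Pending x x' b' → (a , b) ≤lex (fn x' b' , b')
    least b' (p , q) with b' ≟F b
    ... | yes refl = inj₂ (sym M.fn'b , ℕₚ.≤-refl)
    ... | no b'≢b  = contradiction (M.min'⇐ p b'≢b) q
  go {y} c@(step {ℓ = a' , b' , u'} cov' c') ((ℓ≤ℓ' , _) ∷ inc')
    with pend' , yb' , least' , tight' ← increasing⇒first vx' cov' c' inc' =
    (proj₁ (proj₂ mg) , λ p → M.a≢b (trans (sym yb) p)) , yb , least , tight-of-merge vx u mg x'⊑y yb slack≡
    where
    vy = chain-valid vx' c
    x'⊑y = chain⇒⊑ vx' c
    lex : (a , b) ≤lex (a' , b')
    lex = ≤Λ⇒≤lex ℓ≤ℓ'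
    ya : fn y a ≡ a
    -- Otherwise `a` is still pending, in a class whose minimum is smaller than `a`, although the
    -- least pending pair has first entry `a' ≥ a`.
    ya = decidable-stable (fn y a ≟F a) λ q → ℕₚ.<-irrefl refl (ℕₚ.<-≤-trans
      (Finₚ.≤∧≢⇒< (low vy a) q) (ℕₚ.≤-trans (≤lex⇒≤ lex) (≤lex⇒≤ (least' a (M.fn'a , q)))))
    yb : fn y b ≡ a
    yb = trans (sym (merged-same-class vx u mg x'⊑y)) ya
    least : ∀ i → Pending x y i → (a , b) ≤lex (fn y i , i)
    least i p with i ≟F b
    ... | yes refl = inj₂ (sym yb , ℕₚ.≤-refl)
    ... | no i≢b   = ≤lex-trans lex (least' i (pending-merge⁺ {y = y} vx {u = u} mg p i≢b))
    -- Every pending pair now has first entry at least `a'`, so nothing is pending in the class of a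
    -- smaller `a`.
    mins≡ : a Fin.< a' → minsIn (inClass y a) x' ≡ minsIn (inClass y a) y
    mins≡ a<a' = ∑-cong (allFin n) λ {i} _ → pointwise i
      where
      pointwise : ∀ i → (if inClass y a i then χ (isMin x' i) else 0) ≡ (if inClass y a i then χ (isMin y i) else 0)
      pointwise i with fn y i ≟F a
      ... | no _ = refl
      ... | yes p = cong χ (⌊≟⌋-iff to from)
        where
        to : fn x' i ≡ i → fn y i ≡ i
        to q = decidable-stable (fn y i ≟F i) λ r → ℕₚ.<⇒≱ a<a'
          (≤lex⇒≤ (subst (λ z → (a' , b') ≤lex (z , i)) p (least' i (q , r))))
        from : fn y i ≡ i → fn x' i ≡ i
        from r = trans (cong (fn x') (trans (sym r) p)) (trans M.fn'a (trans (sym p) r))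
    slack≡ : u ≡ bit1 → slack (inClass y a) x' ≡ slack (inClass y a) y
    slack≡ refl = by-cases u' ℓ≤ℓ' tight'
      where
      by-cases : ∀ v → (a , b , bit1) ≤Λ (a' , b' , v) → Tight x' y a' v →
                 slack (inClass y a) x' ≡ slack (inClass y a) y
      -- The class of `a` is complete: with equally many minima on both sides, the weight bound
      -- supplies the missing slack inequality.
      by-cases _ (inj₁ a<a') _ =
        ℕₚ.≤-antisym (ℕₚ.+-mono-≤ (weight≤ x'⊑y a) (ℕₚ.≤-reflexive (mins≡ a<a'))) (slack≥ x'⊑y a)
      -- In the same class the ascent forces the next bit to be 1, and its tightness is the required
      -- equality.
      by-cases (Fin.suc _) (inj₂ (refl , _ , _)) t = t

increasing-unique : {x y : Raw n} → Valid x → (c₁ c₂ : Chain x y) →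
                    Increasing c₁ → Increasing c₂ → labels c₁ ≡ labels c₂
increasing-unique vx done done _ _ = refl
increasing-unique {x = x} vx done (step {ℓ = ℓ} cov c) _ _ with mg , refl ← cover⇒ x ℓ cov =
  contradiction c (acyclic ℓ vx mg)
increasing-unique {x = x} vx (step {ℓ = ℓ} cov c) done _ _ with mg , refl ← cover⇒ x ℓ cov =
  contradiction c (acyclic ℓ vx mg)
increasing-unique {x = x} {y} vx (step {ℓ = ℓ} cov₁ c₁) (step {ℓ = ℓ'} cov₂ c₂) inc₁ inc₂
  with refl ← first-unique {x = x} {y} {ℓ} {ℓ'} (increasing⇒first vx cov₁ c₁ inc₁) (increasing⇒first vx cov₂ c₂ inc₂)
  with mg , refl ← cover⇒ x ℓ cov₁ | refl ← proj₂ (cover⇒ x ℓ cov₂) =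
  cong (ℓ ∷_) (increasing-unique (⋆-valid ℓ vx mg) c₁ c₂ (Linked.tail inc₁) (Linked.tail inc₂))

⊑⇒increasing : {x y : Raw n} → Valid x → Valid y → x ⊑ y → Σ (Chain x y) Increasing
⊑⇒increasing vx vy x⊑y =
  let (c , inc , _) = build _ ℕₚ.≤-refl vx x⊑y in c , inc
  where open BuildChain ≤lex-total ≤lex-trans vy (λ {x} {ℓ} {ℓ'} → first-ascent {x = x} {_} {ℓ} {ℓ'})

⊑⇒ascent-free : {x y : Raw n} → Valid x → Valid y → x ⊑ y → Σ (Chain x y) AscentFree
⊑⇒ascent-free {y = y} vx vy x⊑y =
  let (c , af , _) = build _ ℕₚ.≤-refl vx x⊑y in c , af
  where open BuildChain (flip ≤lex-total) (λ {p} {q} {r} s t → ≤lex-trans {i = r} {j = q} {k = p} t s) vy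
               (λ {x} {ℓ} {ℓ'} vx mg _ → last-nonascent {x = x} {y} {ℓ} {ℓ'} vx mg)

-- An ascent forces the two pairs to be disjoint or to share their smaller
-- element.
⋆-comm : {x : Raw n} (ℓ ℓ' : Label n) → Valid x → Mergeable x ℓ → Mergeable (x ⋆ ℓ) ℓ' → ℓ <Λ ℓ' →
         Mergeable x ℓ' × Mergeable (x ⋆ ℓ') ℓ × x ⋆ ℓ ⋆ ℓ' ≡ x ⋆ ℓ' ⋆ ℓ
⋆-comm {n} {x} ℓ@(a , b , u) ℓ'@(a' , b' , u') vx (fa , fb , a<b) (fa'₁ , fb'₁ , a'<b') (ℓ≤ℓ' , _) =
  (fa' , fb' , a'<b') ,
  (M'.min'⇐ fa (≢-sym b'≢a) , M'.min'⇐ fb (≢-sym b'≢b) , a<b) ,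
  raw-ext fn≡ wt≡
  where
  module M = Merge vx u fa fb a<b
  fa' = proj₁ (M.min'⇒ fa'₁)
  a'≢b = proj₂ (M.min'⇒ fa'₁)
  fb' = proj₁ (M.min'⇒ fb'₁)
  b'≢b = proj₂ (M.min'⇒ fb'₁)
  module M' = Merge vx u' fa' fb' a'<b'
  b'≢a : b' ≢ a
  b'≢a refl = ℕₚ.<⇒≱ a'<b' (≤lex⇒≤ (≤Λ⇒≤lex ℓ≤ℓ'))
  x₁ = x ⋆ ℓ
  x₂ = x ⋆ ℓ'
  fn≡ : ∀ i → fn (x₁ ⋆ ℓ') i ≡ fn (x₂ ⋆ ℓ) i
  fn≡ i with fn x i ≟F b | fn x i ≟F b'
  ... | yes p | yes q = contradiction (trans (sym q) p) b'≢b
  ... | yes p | no q = trans (trans (fn-merge-≢ x₁ a' b' u' (λ r → b'≢a (trans (sym r) x₁i))) x₁i)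
                             (sym (fn-merge-≡ x₂ a b u (trans (fn-merge-≢ x a' b' u' q) p)))
    where x₁i = fn-merge-≡ x a b u p
  ... | no p | yes q = trans (fn-merge-≡ x₁ a' b' u' (trans (fn-merge-≢ x a b u p) q))
                             (sym (trans (fn-merge-≢ x₂ a b u (λ r → a'≢b (trans (sym x₂i) r))) x₂i))
    where x₂i = fn-merge-≡ x a' b' u' q
  ... | no p | no q = trans (trans (fn-merge-≢ x₁ a' b' u' (q ∘ trans (sym x₁i))) x₁i)
                            (sym (trans (fn-merge-≢ x₂ a b u (p ∘ trans (sym x₂i))) x₂i))
    where
    x₁i = fn-merge-≢ x a b u p
    x₂i = fn-merge-≢ x a' b' u' q
  wt≡ : ∀ i → wt (x₁ ⋆ ℓ') i ≡ wt (x₂ ⋆ ℓ) i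
  wt≡ i with i ≟F b | i ≟F b'
  ... | yes refl | yes q = contradiction (sym q) b'≢b
  ... | yes refl | no q = trans (wt-merge-≢ x₁ a' b' u' (≢-sym a'≢b) q)
                            (trans (wt-merge-b x a b u (≢-sym M.a≢b) refl)
                                   (sym (wt-merge-b x₂ a b u (≢-sym M.a≢b) refl)))
  ... | no p | yes refl = trans (wt-merge-b x₁ a' b' u' (≢-sym M'.a≢b) refl)
                            (sym (trans (wt-merge-≢ x₂ a b u b'≢a p)
                                        (wt-merge-b x a' b' u' (≢-sym M'.a≢b) refl)))
  ... | no p | no q with i ≟F a | i ≟F a'
  ...   | no r | no s = trans (trans (wt-merge-≢ x₁ a' b' u' s q) (wt-merge-≢ x a b u r p))
                          (sym (trans (wt-merge-≢ x₂ a b u r p) (wt-merge-≢ x a' b' u' s q)))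
  ...   | yes refl | no s = trans (trans (wt-merge-≢ x₁ a' b' u' s q) (wt-merge-a x a b u refl))
                          (sym (trans (wt-merge-a x₂ a b u refl)
                            (cong₂ (λ v w → v + w + toℕ u) (wt-merge-≢ x a' b' u' s q)
                                   (wt-merge-≢ x a' b' u' (≢-sym a'≢b) (≢-sym b'≢b)))))
  ...   | no r | yes refl = trans (trans (wt-merge-a x₁ a' b' u' refl)
                            (cong₂ (λ v w → v + w + toℕ u') (wt-merge-≢ x a b u r p)
                                   (wt-merge-≢ x a b u b'≢a b'≢b)))
                          (sym (trans (wt-merge-≢ x₂ a b u r p) (wt-merge-a x a' b' u' refl)))
  ...   | yes refl | yes refl = begin
    wt (x₁ ⋆ ℓ') i ≡⟨ wt-merge-a x₁ a' b' u' refl ⟩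
    wt x₁ i + wt x₁ b' + toℕ u'
      ≡⟨ cong₂ (λ v w → v + w + toℕ u') (wt-merge-a x a b u refl) (wt-merge-≢ x a b u b'≢a b'≢b) ⟩
    wt x i + wt x b + toℕ u + wt x b' + toℕ u' ≡⟨ shuffle (wt x i) (wt x b) (toℕ u) (wt x b') (toℕ u') ⟩
    wt x i + wt x b' + toℕ u' + wt x b + toℕ u
      ≡⟨ cong₂ (λ v w → v + w + toℕ u) (wt-merge-a x a' b' u' refl)
               (wt-merge-≢ x a' b' u' (≢-sym a'≢b) (≢-sym b'≢b)) ⟨
    wt x₂ i + wt x₂ b + toℕ u ≡⟨ wt-merge-a x₂ a b u refl ⟨
    wt (x₂ ⋆ ℓ) i ∎
    where
    open ≡-Reasoning
    shuffle : ∀ p q r s t → p + q + r + s + t ≡ p + s + t + q + r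
    shuffle = solve-∀

-- The conditions of an EW-labeling

λw-EW : ∀ n → λw-IsEW n
λw-EW n = er , switching , λ x y _ c₁ c₂ _ _ → labels⇒elems c₁ c₂
  where
  er : IsER IsWeightedPartition
  er x y dx c = ⊑⇒increasing vx (chain-valid vx c) (chain⇒⊑ vx c) ,
                λ c₁ c₂ i₁ i₂ → labels⇒elems c₁ c₂ (increasing-unique vx c₁ c₂ i₁ i₂)
    where vx = valid⇒ x dx
  switching : RankTwoSwitching IsWeightedPartition
  switching x y dx (step {ℓ = ℓ} cov (step {ℓ = ℓ'} cov' done)) (ℓ<ℓ' ∷ _) _ _ refl
    with mg , refl ← cover⇒ x ℓ cov
    with mg' , refl ← cover⇒ (x ⋆ ℓ) ℓ' cov'
    with nmg , nmg' , eq ← ⋆-comm ℓ ℓ' (valid⇒ x dx) mg mg' ℓ<ℓ' =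
    (subst (λ y → Σ (Chain x y) λ c → labels c ≡ ℓ' ∷ ℓ ∷ []) (sym eq)
      (step (cover⇐ x ℓ' nmg) (step (cover⇐ (x ⋆ ℓ') ℓ nmg') done) , refl)) ,
    λ c₁ c₂ l₁ l₂ → labels⇒elems c₁ c₂ (trans l₁ (sym l₂))

open import Data.Integer using (+_; -_)

-- Möbius functions

module Moebius {A : Set} (els : List A) (le : A → A → Bool) (bot : A) (rank : A → ℕ) where
  open Whitney els le bot rank public

  lt⇒ : ∀ {x y} → T (lt x y) → T (le x y) × ¬ T (le y x)
  lt⇒ {x} {y} h with le x y | le y x
  ... | true | false = _ , λ ()

  lt⇐ : ∀ {x y} → T (le x y) → ¬ T (le y x) → T (lt x y)
  lt⇐ {x} {y} p q with le x y | le y x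
  ... | true | false = _
  ... | true | true  = contradiction _ q

  module _ (le-trans : ∀ {x y z} → x ∈ els → y ∈ els → z ∈ els → T (le x y) → T (le y z) → T (le x z)) where

    private
      below : A → ℕ
      below x = ∑ (λ z → χ (lt z x)) els

      χ-mono : ∀ {b c} → (T b → T c) → χ b ≤ χ c
      χ-mono {false}        f = z≤n
      χ-mono {true} {true}  f = s≤s z≤n
      χ-mono {true} {false} f = contradiction _ f

      χ-irrefl : ∀ x → χ (lt x x) ≡ 0
      χ-irrefl x with le x x
      ... | true  = refl
      ... | false = refl

      χ≡1 : ∀ {b} → T b → χ b ≡ 1
      χ≡1 {true} _ = refl

      below-< : ∀ {x y} → x ∈ els → y ∈ els → T (lt x y) → below x < below y
      below-< {x} {y} x∈ y∈ x<y = ∑-mono-< els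
        (λ {z} z∈ → χ-mono λ z<x →
          let (z≤x , x≰z) = lt⇒ z<x ; (x≤y , y≰x) = lt⇒ x<y in
          lt⇐ (le-trans z∈ x∈ y∈ z≤x x≤y) (λ y≤z → x≰z (le-trans x∈ y∈ z∈ x≤y y≤z)))
        x∈ (subst₂ _<_ (sym (χ-irrefl x)) (sym (χ≡1 x<y)) (s≤s z≤n))

      χ≤1 : ∀ b → χ b ≤ 1
      χ≤1 true  = s≤s z≤n
      χ≤1 false = z≤n

      below-length : ∀ {x} → x ∈ els → below x < length els
      below-length {x} x∈ = subst (below x <_) (sym (length-∑ els))
        (∑-mono-< els (λ {z} _ → χ≤1 (lt z x)) x∈ (subst (_< 1) (sym (χ-irrefl x)) (s≤s z≤n)))

    -- Fuel exceeding the number of elements strictly below `x` is enough, and `length els` exceeds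
    -- it because `x` is not below itself. Transitivity is asked for inside `els`, as it is derived
    -- for valid pairs.
    μ₀-unique : (ν : A → ℤ) →
                (∀ {x} → x ∈ els → T (le x bot) → ν x ≡ + 1) →
                (∀ {x} → x ∈ els → ¬ T (le x bot) →
                   ν x ≡ - ℤΣ.∑ ν (filterᵇ (λ z → lt z x) els)) →
                ∀ {x} → x ∈ els → μ₀ x ≡ ν x
    μ₀-unique ν ν-bot ν-rec x∈ = go (length els) x∈ (below-length x∈)
      where
      go : ∀ k {x} → x ∈ els → below x < k → mob k x ≡ ν x
      go (suc k) {x} x∈ (s≤s b≤k) with le x bot in eq
      ... | true  = sym (ν-bot x∈ (Equivalence.from T-≡ eq))
      ... | false = trans (cong -_ (trans (ℤΣ.∑-foldr (mob k) below-x) (ℤΣ.∑-cong below-x go-below)))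
                      (sym (ν-rec x∈ (subst T eq)))
        where
        below-x = filterᵇ (λ z → lt z x) els
        go-below : ∀ {z} → z ∈ below-x → mob k z ≡ ν z
        go-below z∈ with z∈els , z<x ← ∈-filter⁻ (T? ∘ λ z → lt z x) {xs = els} z∈ =
          go k z∈els (ℕₚ.<-≤-trans (below-< z∈els x∈ z<x) b≤k)

-- Signs, and enumerations of labels and weighted partitions

sgn : ℕ → ℤ
sgn zero    = + 1
sgn (suc k) = - sgn k

∣sgn∣ : ∀ k → ℤ.∣ sgn k ∣ ≡ 1
∣sgn∣ zero    = refl
∣sgn∣ (suc k) = trans (ℤₚ.∣-i∣≡∣i∣ (sgn k)) (∣sgn∣ k)

∣sgn*∣ : ∀ k m → ℤ.∣ sgn k ℤ.* + m ∣ ≡ m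
∣sgn*∣ k m = trans (ℤₚ.abs-* (sgn k) (+ m)) (trans (cong (ℕ._* m) (∣sgn∣ k)) (ℕₚ.*-identityˡ m))

module _ {n : ℕ} where

  allLabels-complete : (ℓ : Label n) → ℓ ∈ allLabels n
  allLabels-complete (a , b , u) =
    ∈-cartesianProduct⁺ (∈-allFin a) (∈-cartesianProduct⁺ (∈-allFin b) (∈-allFin u))

  allLabels-unique : Unique (allLabels n)
  allLabels-unique =
    Uniqueₚ.cartesianProduct⁺ (Uniqueₚ.allFin⁺ n)
      (Uniqueₚ.cartesianProduct⁺ (Uniqueₚ.allFin⁺ n) (Uniqueₚ.allFin⁺ 2))

allVecs-complete : ∀ {A : Set} {k} {xs : List A} (v : Vec A k) → (∀ i → Vec.lookup v i ∈ xs) → v ∈ allVecs k xs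
allVecs-complete Vec.[]       _   = here refl
allVecs-complete (x Vec.∷ v) in? =
  ∈-concatMap⁺ _ (lose (in? Fin.zero) (∈-map⁺ _ (allVecs-complete v (in? ∘ Fin.suc))))

allVecs-unique : ∀ {A : Set} k {xs : List A} → Unique xs → Unique (allVecs k xs)
allVecs-unique zero    u = [] ∷ []
allVecs-unique (suc k) {xs} u = Uniqueₚ.concat⁺
  (Allₚ.map⁺ (All.tabulate λ _ → Uniqueₚ.map⁺ (λ { refl → refl }) (allVecs-unique k u)))
  (AllPairsₚ.map⁺ (AllPairs.map disjoint u))
  where
  disjoint : ∀ {x y} → x ≢ y → ∀ {v} →
             ¬ (v ∈ map (x Vec.∷_) (allVecs k xs) × v ∈ map (y Vec.∷_) (allVecs k xs))
  disjoint x≢y (p , q) with _ , _ , refl ← ∈-map⁻ _ p | _ , _ , refl ← ∈-map⁻ _ q = x≢y refl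

Πw-unique : ∀ n → Unique (Πw-elems n)
Πw-unique n = Uniqueₚ.filter⁺ (T? ∘ valid?)
  (Uniqueₚ.cartesianProduct⁺ (allVecs-unique n (Uniqueₚ.allFin⁺ n)) (allVecs-unique n (Uniqueₚ.upTo⁺ n)))

Πw-complete : ∀ {n} {x : Raw n} → Valid x → x ∈ Πw-elems n
Πw-complete {n} {x} vx = ∈-filter⁺ (T? ∘ valid?)
  (∈-cartesianProduct⁺ (allVecs-complete (proj₁ x) λ i → ∈-allFin _)
                       (allVecs-complete (proj₂ x) λ i → ∈-upTo⁺ (bound i)))
  (valid⇐ x vx)
  where
  bound : ∀ i → wt x i < n
  bound i with fn x i ≟F i
  ... | yes p = ℕₚ.<-≤-trans (wt< vx i p) (subst (blockSize x i ≤_) (Listₚ.length-tabulate {n = n} (λ j → j))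
                  (Listₚ.length-filter (T? ∘ inClass x i) (allFin n)))
  ... | no ¬p = subst (_< n) (sym (wt0 vx i ¬p)) (ℕₚ.≤-trans (s≤s z≤n) (Finₚ.toℕ<n i))

Πw-sound : ∀ {n} {x : Raw n} → x ∈ Πw-elems n → Valid x
Πw-sound x∈ = valid⇒ _ (proj₂ (∈-filter⁻ (T? ∘ valid?) {xs = cartesianProduct (allVecs _ (allFin _)) (allVecs _ (upTo _))} x∈))

isCover?⇒ : ∀ {n} (x : Raw n) (ℓ : Label n) → T (isCover? x ℓ) → Mergeable x ℓ
isCover?⇒ x (a , b , u) h =
  let (ma , h') = Equivalence.to (T-∧ {isMin x a}) h
      (mb , lt) = Equivalence.to (T-∧ {isMin x b}) h' in
  toWitness ma , toWitness mb , ℕₚ.<ᵇ⇒< _ _ lt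

isCover?⇐ : ∀ {n} (x : Raw n) (ℓ : Label n) → Mergeable x ℓ → T (isCover? x ℓ)
isCover?⇐ x (a , b , u) (fa , fb , a<b) =
  Equivalence.from (T-∧ {isMin x a}) (fromWitness fa ,
  Equivalence.from (T-∧ {isMin x b}) (fromWitness fb , ℕₚ.<⇒<ᵇ a<b))

-- The Boolean order, the rank and the minimum in terms of chains

module _ {n : ℕ} where

  reach⇒chain : ∀ k {x y : Raw n} → T (reach? k x y) → Chain x y
  reach⇒chain zero h with refl ← toWitness h = done
  reach⇒chain (suc k) {x} {y} h with Equivalence.to (T-∨ {⌊ x ≟R y ⌋}) h
  ... | inj₁ p with refl ← toWitness p = done
  ... | inj₂ p with ℓ , q ← satisfied (any⁻ _ (allLabels n) p) =
    let (cov , r) = Equivalence.to (T-∧ {isCover? x ℓ}) q in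
    step (cover⇐ x ℓ (isCover?⇒ x ℓ cov)) (reach⇒chain k r)

  chain⇒reach : ∀ k {x y : Raw n} → Valid x → #mins x ≤ k → Chain x y → T (reach? k x y)
  chain⇒reach zero    vx x≤k done = fromWitness refl
  chain⇒reach (suc k) {x} {y} vx x≤k done = Equivalence.from (T-∨ {⌊ x ≟R y ⌋}) (inj₁ (fromWitness refl))
  chain⇒reach zero    {x} vx x≤k (step {ℓ = ℓ} cov c) =
    contradiction (subst (_≤ 0) (#mins-⋆ ℓ vx (proj₁ (cover⇒ x ℓ cov))) x≤k) λ ()
  chain⇒reach (suc k) {x} {y} vx x≤k (step {ℓ = ℓ} cov c) with mg , refl ← cover⇒ x ℓ cov =
    Equivalence.from (T-∨ {⌊ x ≟R y ⌋}) (inj₂ (any⁺ _ (lose (allLabels-complete ℓ)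
      (Equivalence.from (T-∧ {isCover? x ℓ}) (isCover?⇐ x ℓ mg ,
        chain⇒reach k (⋆-valid ℓ vx mg) (ℕₚ.≤-pred (subst (_≤ suc k) (#mins-⋆ ℓ vx mg) x≤k)) c)))))

  #mins≤n : (x : Raw n) → #mins x ≤ n
  #mins≤n x = subst (_≤ n) (length-filterᵇ-∑ (isMin x) (allFin n))
    (subst (length (filterᵇ (isMin x) (allFin n)) ≤_) (Listₚ.length-tabulate {n = n} (λ j → j))
      (Listₚ.length-filter (T? ∘ isMin x) (allFin n)))

  le⇒chain : {x y : Raw n} → T (Πw-le n x y) → Chain x y
  le⇒chain = reach⇒chain n

  chain⇒le : {x y : Raw n} → Valid x → Chain x y → T (Πw-le n x y)
  chain⇒le {x} vx = chain⇒reach n vx (#mins≤n x)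

  chain-++ : {x y z : Raw n} → Chain x y → Chain y z → Chain x z
  chain-++ done         d = d
  chain-++ (step cov c) d = step cov (chain-++ c d)

  chain-antisym : {x y : Raw n} → Valid x → Chain x y → Chain y x → x ≡ y
  chain-antisym vx done d = refl
  chain-antisym {x} vx (step {ℓ = ℓ} cov c) d with mg , refl ← cover⇒ x ℓ cov =
    contradiction (chain-++ c d) (acyclic ℓ vx mg)

  rank-#mins : (x : Raw n) → Πw-rank n x ≡ n ∸ #mins x
  rank-#mins x = cong (n ∸_) (length-filterᵇ-∑ (isMin x) (allFin n))

  rank-⋆ : {x : Raw n} (ℓ : Label n) → Valid x → Mergeable x ℓ → Πw-rank n (x ⋆ ℓ) ≡ suc (Πw-rank n x)
  rank-⋆ {x} ℓ vx mg = begin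
    Πw-rank n (x ⋆ ℓ)             ≡⟨ rank-#mins (x ⋆ ℓ) ⟩
    -- No truncation occurs, as `suc (#mins (x ⋆ ℓ)) = #mins x ≤ n`.
    n ∸ #mins (x ⋆ ℓ)             ≡⟨ ℕₚ.+-∸-assoc 1 (subst (_≤ n) (#mins-⋆ ℓ vx mg) (#mins≤n x)) ⟩
    suc (n ∸ suc (#mins (x ⋆ ℓ))) ≡⟨ cong (λ k → suc (n ∸ k)) (#mins-⋆ ℓ vx mg) ⟨
    suc (n ∸ #mins x)             ≡⟨ cong suc (rank-#mins x) ⟨
    suc (Πw-rank n x)             ∎
    where open ≡-Reasoning

  Πw-bot-fn : ∀ i → fn (Πw-bot n) i ≡ i
  Πw-bot-fn = lookup∘tabulate _

  Πw-bot-wt : ∀ i → wt (Πw-bot n) i ≡ 0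
  Πw-bot-wt i = lookup-replicate i 0

  Πw-bot-valid : Valid (Πw-bot n)
  Πw-bot-valid = record
    { idem = λ i → cong (fn (Πw-bot n)) (Πw-bot-fn i)
    ; low  = λ i → ℕₚ.≤-reflexive (cong toℕ (Πw-bot-fn i))
    ; wt<  = λ i p → subst₂ _<_ (sym (Πw-bot-wt i)) (sym (blockSize-∑ (Πw-bot n) i))
               (ℕₚ.≤-trans (ℕₚ.≤-reflexive (sym (cong χ (⌊≟⌋-true p))))
                           (term≤∑ (χ ∘ inClass (Πw-bot n) i) (allFin n) (∈-allFin i)))
    ; wt0  = λ i _ → Πw-bot-wt i }

  isMin-bot : ∀ i → isMin (Πw-bot n) i ≡ true
  isMin-bot i = ⌊≟⌋-true (Πw-bot-fn i)

  -- In a class of `x` the minimum has weight 0 and slack equal to the block size, so the bounds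
  -- become 0 ≤ weight and weight + 1 ≤ block size: the range allowed for weights.
  Πw-bot-⊑ : {x : Raw n} → Valid x → Πw-bot n ⊑ x
  Πw-bot-⊑ {x} vx = record
    { coarse  = λ i → cong (fn x) (Πw-bot-fn i)
    ; weight≤ = λ r → subst (_≤ weightIn (inClass x r) x) (sym (bot-weight r)) z≤n
    ; slack≥  = λ r → subst (slack (inClass x r) x ≤_) (sym (bot-slack r)) (slack≤size r) }
    where
    bot-weight : ∀ r → weightIn (inClass x r) (Πw-bot n) ≡ 0
    bot-weight r = ∑-zero (allFin n) λ {i} _ →
      trans (cong (λ v → if inClass x r i then v else 0) (Πw-bot-wt i)) (if-same (inClass x r i))
      where
      if-same : ∀ b → (if b then 0 else 0) ≡ 0
      if-same true  = refl
      if-same false = refl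
    bot-slack : ∀ r → slack (inClass x r) (Πw-bot n) ≡ blockSize x r
    bot-slack r = trans (cong (_+ minsIn (inClass x r) (Πw-bot n)) (bot-weight r))
      (trans (∑-cong (allFin n) λ {i} _ → cong (λ b → if inClass x r i then χ b else 0) (isMin-bot i))
             (sym (blockSize-∑ x r)))
    slack≤size : ∀ r → slack (inClass x r) x ≤ blockSize x r
    slack≤size r with fn x r ≟F r
    ... | yes p = subst (_≤ blockSize x r) (sym (trans
            (cong₂ _+_ (weightIn-class {y = x} vx (λ _ → refl) p)
                       (trans (∑-allFin-single r offmin) (trans (if-true (⌊≟⌋-true p)) (cong χ (⌊≟⌋-true p)))))
            (ℕₚ.+-comm _ 1))) (wt< vx r p)
      where
      offmin : ∀ j → j ≢ r → (if inClass x r j then χ (isMin x j) else 0) ≡ 0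
      offmin j j≢r with fn x j ≟F r
      ... | no _  = refl
      ... | yes q = cong χ (⌊≟⌋-false λ s → j≢r (trans (sym s) q))
    -- The class is empty here: any point sent to `r` would make `r` a minimum by idempotence.
    ... | no ¬p = subst (_≤ blockSize x r) (sym (cong₂ _+_ (∑-zero (allFin n) λ {i} _ → empty i _)
                                                           (∑-zero (allFin n) λ {i} _ → empty i _))) z≤n
      where
      empty : ∀ i v → (if inClass x r i then v else 0) ≡ 0
      empty i v = if-false (⌊≟⌋-false λ q → ¬p (trans (cong (fn x) (sym q)) (trans (idem vx i) q)))

  bot-chain : {x : Raw n} → Valid x → Chain (Πw-bot n) x
  bot-chain vx = proj₁ (⊑⇒increasing Πw-bot-valid vx (Πw-bot-⊑ vx))

  #mins-bot : #mins (Πw-bot n) ≡ n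
  #mins-bot = trans (∑-cong (allFin n) λ {i} _ → cong χ (isMin-bot i))
                (trans (sym (length-∑ (allFin n))) (Listₚ.length-tabulate {n = n} λ j → j))

  Πw-rank-bot : Πw-rank n (Πw-bot n) ≡ 0
  Πw-rank-bot = trans (rank-#mins (Πw-bot n)) (trans (cong (n ∸_) #mins-bot) (ℕₚ.n∸n≡0 n))

-- Signed counts of ascent-free chains

_<Λ?_ : ∀ {n} (ℓ ℓ' : Label n) → Dec (ℓ <Λ ℓ')
(a , b , u) <Λ? (a' , b' , u') =
  ((a Finₚ.<? a') ⊎-dec ((a ≟F a') ×-dec ((b Finₚ.≤? b') ×-dec (u Finₚ.≤? u')))) ×-dec
  ¬? (≡-dec× _≟F_ (≡-dec× _≟F_ _≟F_) (a , b , u) (a' , b' , u'))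

nonascent : ∀ {n} → Label n → Label n → Bool
nonascent ℓ ℓ' = not ⌊ ℓ <Λ? ℓ' ⌋

nonascent-< : ∀ {n} {ℓ ℓ' : Label n} → ℓ <Λ ℓ' → nonascent ℓ ℓ' ≡ false
nonascent-< {ℓ = ℓ} {ℓ'} p with ℓ <Λ? ℓ'
... | yes _ = refl
... | no ¬p = contradiction p ¬p

nonascent-≮ : ∀ {n} {ℓ ℓ' : Label n} → ¬ (ℓ <Λ ℓ') → nonascent ℓ ℓ' ≡ true
nonascent-≮ {ℓ = ℓ} {ℓ'} ¬p with ℓ <Λ? ℓ'
... | yes p = contradiction p ¬p
... | no _  = refl

module _ {n : ℕ} where

  -- The number of ascent-free chains from z to t of length at most k whose
  -- first label, if any, satisfies p.
  #ascent-free : ℕ → Raw n → (Label n → Bool) → Raw n → ℕ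
  #ascent-free zero    z p t = χ ⌊ z ≟R t ⌋
  #ascent-free (suc k) z p t = χ ⌊ z ≟R t ⌋ +
    ∑ (λ ℓ → if isCover? z ℓ ∧ p ℓ then #ascent-free k (z ⋆ ℓ) (nonascent ℓ) t else 0) (allLabels n)

  -- The value `false` on the empty chain matters: with no first label to follow, no second term
  -- appears and the sign in `weighted-≤` stays.
  startsIn : (Label n → Bool) → ∀ {x y} → Chain x y → Bool
  startsIn p done                = false
  startsIn p (step {ℓ = ℓ} _ _) = p ℓ

  #ascent-free-pos : ∀ k {z t} p → Valid z → #mins z ≤ k → (c : Chain z t) → AscentFree c →
                     (∀ {ℓ ls} → labels c ≡ ℓ ∷ ls → T (p ℓ)) → 1 ≤ #ascent-free k z p t
  #ascent-free-pos zero {z} p vz z≤k done af first = ℕₚ.≤-reflexive (cong χ (sym (T⇒≡true (fromWitness {a? = z ≟R z} refl))))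
  #ascent-free-pos (suc k) {z} p vz z≤k done af first =
    ℕₚ.≤-trans (ℕₚ.≤-reflexive (cong χ (sym (T⇒≡true (fromWitness {a? = z ≟R z} refl))))) (ℕₚ.m≤m+n _ _)
  #ascent-free-pos zero {z} p vz z≤k (step {ℓ = ℓ} cov c) af first =
    contradiction (subst (_≤ 0) (#mins-⋆ ℓ vz (proj₁ (cover⇒ z ℓ cov))) z≤k) λ ()
  #ascent-free-pos (suc k) {z} {t} p vz z≤k (step {ℓ = ℓ} cov c) af first with mg , refl ← cover⇒ z ℓ cov =
    ℕₚ.≤-trans (ℕₚ.≤-trans (#ascent-free-pos k (nonascent ℓ) (⋆-valid ℓ vz mg)
                              (ℕₚ.≤-pred (subst (_≤ suc k) (#mins-⋆ ℓ vz mg) z≤k)) c (Linked.tail af) (next c af))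
                           (ℕₚ.≤-reflexive (sym (if-true (cong₂ _∧_ (T⇒≡true (isCover?⇐ z ℓ mg)) (T⇒≡true (first refl)))))))
      (ℕₚ.≤-trans (term≤∑ (λ ℓ → if isCover? z ℓ ∧ p ℓ then #ascent-free k (z ⋆ ℓ) (nonascent ℓ) t else 0)
                          (allLabels n) (allLabels-complete ℓ))
                  (ℕₚ.m≤n+m _ (χ ⌊ z ≟R t ⌋)))
    where
    next : ∀ {x y} (c : Chain x y) → Linked (λ a b → ¬ (a <Λ b)) (ℓ ∷ labels c) →
           ∀ {ℓ' ls} → labels c ≡ ℓ' ∷ ls → T (nonascent ℓ ℓ')
    next (step _ _) (¬ℓ<ℓ' ∷ _) refl = Equivalence.from T-≡ (nonascent-≮ ¬ℓ<ℓ')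

  weighted : (Raw n → ℤ) → ℕ → Raw n → (Label n → Bool) → ℤ
  weighted φ k z p = ℤΣ.∑ (λ t → φ t ℤ.* + #ascent-free k z p t) (Πw-elems n)

  private
    *-if : ∀ (i : ℤ) b m → i ℤ.* + (if b then m else 0) ≡ (if b then i ℤ.* + m else + 0)
    *-if i true  m = refl
    *-if i false m = ℤₚ.*-zeroʳ i

  weighted-δ : (φ : Raw n → ℤ) {z : Raw n} → Valid z → ℤΣ.∑ (λ t → φ t ℤ.* + χ ⌊ z ≟R t ⌋) (Πw-elems n) ≡ φ z
  weighted-δ φ {z} vz = trans (ℤΣ.∑-single (Πw-elems n) (Πw-unique n) (Πw-complete vz) off)
    (trans (cong (λ b → φ z ℤ.* + χ b) (T⇒≡true (fromWitness {a? = z ≟R z} refl))) (ℤₚ.*-identityʳ (φ z)))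
    where
    off : ∀ {t} → t ∈ Πw-elems n → t ≢ z → φ t ℤ.* + χ ⌊ z ≟R t ⌋ ≡ + 0
    off {t} _ t≢z = trans (cong (λ b → φ t ℤ.* + χ b)
                            (¬T⇒≡false λ h → t≢z (sym (toWitness {a? = z ≟R t} h))))
                          (ℤₚ.*-zeroʳ (φ t))

  -- Splits the ascent-free chains at their first label; the next label must then be a non-ascent
  -- from it.
  weighted-suc : (φ : Raw n → ℤ) (k : ℕ) {z : Raw n} (p : Label n → Bool) → Valid z →
    weighted φ (suc k) z p ≡
    φ z ℤ.+ ℤΣ.∑ (λ ℓ → if isCover? z ℓ ∧ p ℓ then weighted φ k (z ⋆ ℓ) (nonascent ℓ) else + 0) (allLabels n)
  weighted-suc φ k {z} p vz = begin
    weighted φ (suc k) z p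
      ≡⟨ ℤΣ.∑-cong els (λ {t} _ → trans (cong (φ t ℤ.*_) (ℤₚ.pos-+ (δ t) _)) (ℤₚ.*-distribˡ-+ (φ t) (+ δ t) _)) ⟩
    ℤΣ.∑ (λ t → φ t ℤ.* + δ t ℤ.+ φ t ℤ.* + ∑ (g t) (allLabels n)) els
      ≡⟨ ℤΣ.∑-∙ (λ t → φ t ℤ.* + δ t) _ els ⟩
    ℤΣ.∑ (λ t → φ t ℤ.* + δ t) els ℤ.+ ℤΣ.∑ (λ t → φ t ℤ.* + ∑ (g t) (allLabels n)) els
      ≡⟨ cong₂ ℤ._+_ (weighted-δ φ vz) (ℤΣ.∑-cong els λ {t} _ →
           trans (cong (φ t ℤ.*_) (pos-∑ (g t) (allLabels n))) (*-∑ (φ t) _ (allLabels n))) ⟩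
    φ z ℤ.+ ℤΣ.∑ (λ t → ℤΣ.∑ (λ ℓ → φ t ℤ.* + g t ℓ) (allLabels n)) els
      ≡⟨ cong (λ s → φ z ℤ.+ s) (ℤΣ.∑-swap _ els (allLabels n)) ⟩
    φ z ℤ.+ ℤΣ.∑ (λ ℓ → ℤΣ.∑ (λ t → φ t ℤ.* + g t ℓ) els) (allLabels n)
      ≡⟨ cong (λ s → φ z ℤ.+ s) (ℤΣ.∑-cong (allLabels n) λ {ℓ} _ →
           trans (ℤΣ.∑-cong els λ {t} _ → *-if (φ t) (q ℓ) _) (sym (ℤΣ.if-∑ (q ℓ) _ els))) ⟩
    φ z ℤ.+ ℤΣ.∑ (λ ℓ → if q ℓ then weighted φ k (z ⋆ ℓ) (nonascent ℓ) else + 0) (allLabels n) ∎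
    where
    open ≡-Reasoning
    els = Πw-elems n
    δ : Raw n → ℕ
    δ t = χ ⌊ z ≟R t ⌋
    q : Label n → Bool
    q ℓ = isCover? z ℓ ∧ p ℓ
    g : Raw n → Label n → ℕ
    g t ℓ = if q ℓ then #ascent-free k (z ⋆ ℓ) (nonascent ℓ) t else 0

  module _ {x : Raw n} (vx : Valid x) where

    -- The indicator of `t ≤ x` is the number of increasing chains from `t` to `x`, so with these
    -- weights `weighted` is the signed count of pairs of an ascent-free and an increasing chain.
    below-sgn : Raw n → ℤ
    below-sgn t = if Πw-le n t x then sgn (Πw-rank n t) else + 0

    weighted-≰ : ∀ k {z} p → Valid z → ¬ Chain z x → weighted below-sgn k z p ≡ + 0
    weighted-≰ zero {z} p vz z≰x = trans (weighted-δ below-sgn vz) (if-false (¬T⇒≡false (z≰x ∘ le⇒chain)))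
    weighted-≰ (suc k) {z} p vz z≰x = trans (weighted-suc below-sgn k p vz)
      (cong₂ ℤ._+_ (if-false (¬T⇒≡false (z≰x ∘ le⇒chain))) (ℤΣ.∑-zero (allLabels n) λ {ℓ} _ → vanish ℓ))
      where
      vanish : ∀ ℓ → (if isCover? z ℓ ∧ p ℓ then weighted below-sgn k (z ⋆ ℓ) (nonascent ℓ) else + 0) ≡ + 0
      vanish ℓ with isCover? z ℓ in cov | p ℓ
      ... | false | _     = refl
      ... | true  | false = refl
      ... | true  | true  = let mg = isCover?⇒ z ℓ (Equivalence.from T-≡ cov) in
        weighted-≰ k (nonascent ℓ) (⋆-valid ℓ vz mg) (λ c → z≰x (step (cover⇐ z ℓ mg) c))

    -- Exactly one label out of z starts an increasing chain to x, so the terms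
    -- of weighted-suc cancel except at the increasing chain itself.
    weighted-≤ : ∀ k {z} p → Valid z → #mins z ≤ k → (c : Chain z x) → Increasing c →
                 weighted below-sgn k z p ≡ (if startsIn p c then + 0 else sgn (Πw-rank n z))

    private
      -- Either `x` is not above `z ⋆ ℓ`, or the increasing chain from there starts with a
      -- non-ascent from `ℓ` and the inductive value is 0. An ascent would put `ℓ` in front of it to
      -- form an increasing chain out of `z`, which the callers exclude.
      vanish : ∀ k {z} (vz : Valid z) → #mins z ≤ suc k → ∀ (p : Label n → Bool) ℓ →
               (Mergeable z ℓ → (c : Chain (z ⋆ ℓ) x) → Increasing c → startsIn (nonascent ℓ) c ≡ true) →
               (if isCover? z ℓ ∧ p ℓ then weighted below-sgn k (z ⋆ ℓ) (nonascent ℓ) else + 0) ≡ + 0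
      vanish k {z} vz z≤k p ℓ starts with isCover? z ℓ in cov | p ℓ
      ... | false | _     = refl
      ... | true  | false = refl
      ... | true  | true with mg ← isCover?⇒ z ℓ (Equivalence.from T-≡ cov) with T? (Πw-le n (z ⋆ ℓ) x)
      ...   | no h  = weighted-≰ k (nonascent ℓ) (⋆-valid ℓ vz mg) (h ∘ chain⇒le (⋆-valid ℓ vz mg))
      ...   | yes h with c , inc ← ⊑⇒increasing (⋆-valid ℓ vz mg) vx (chain⇒⊑ (⋆-valid ℓ vz mg) (le⇒chain h)) =
        trans (weighted-≤ k (nonascent ℓ) (⋆-valid ℓ vz mg)
                 (ℕₚ.≤-pred (subst (_≤ suc k) (#mins-⋆ ℓ vz mg) z≤k)) c inc)
              (if-true (starts mg c inc))

      extend : ∀ {y} ℓ (c : Chain y x) → Increasing c →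
               startsIn (nonascent ℓ) c ≡ true ⊎ Linked _<Λ_ (ℓ ∷ labels c)
      extend ℓ done inc = inj₂ [-]
      extend ℓ (step {ℓ = ℓ'} _ c) inc with ℓ <Λ? ℓ'
      ... | yes p = inj₂ (p ∷ inc)
      ... | no _  = inj₁ refl

      ascends : ∀ {y} ℓ (c : Chain y x) → Linked _<Λ_ (ℓ ∷ labels c) → startsIn (nonascent ℓ) c ≡ false
      ascends ℓ done       _       = refl
      ascends ℓ (step _ c) (p ∷ _) = nonascent-< p

      below-sgn-≤ : ∀ {z} → Valid z → Chain z x → below-sgn z ≡ sgn (Πw-rank n z)
      below-sgn-≤ vz c = if-true (T⇒≡true (chain⇒le vz c))

    weighted-≤ zero p vz z≤k done inc = trans (weighted-δ below-sgn vz) (below-sgn-≤ vz done)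
    weighted-≤ zero {z} p vz z≤k (step {ℓ = ℓ} cov c) inc =
      contradiction (subst (_≤ 0) (#mins-⋆ ℓ vz (proj₁ (cover⇒ z ℓ cov))) z≤k) λ ()
    weighted-≤ (suc k) p vz z≤k done inc = trans (weighted-suc below-sgn k p vz)
      (trans (cong₂ ℤ._+_ (below-sgn-≤ vz done)
                (ℤΣ.∑-zero (allLabels n) λ {ℓ} _ → vanish k vz z≤k p ℓ λ mg c _ → contradiction c (acyclic ℓ vz mg)))
             (ℤₚ.+-identityʳ _))
    weighted-≤ (suc k) {z} p vz z≤k c@(step {ℓ = ℓ} cov c') inc with mg , refl ← cover⇒ z ℓ cov = begin
      weighted below-sgn (suc k) z p
        ≡⟨ weighted-suc below-sgn k p vz ⟩
      below-sgn z ℤ.+ ℤΣ.∑ term (allLabels n)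
        ≡⟨ cong₂ ℤ._+_ (below-sgn-≤ vz c) (ℤΣ.∑-single (allLabels n) allLabels-unique (allLabels-complete ℓ) off) ⟩
      sgn (Πw-rank n z) ℤ.+ term ℓ
        ≡⟨ cong (λ i → sgn (Πw-rank n z) ℤ.+ i) (trans (cong (λ b → if b ∧ p ℓ then W else + 0) (T⇒≡true (isCover?⇐ z ℓ mg)))
             (cong (λ i → if p ℓ then i else + 0) W≡)) ⟩
      sgn (Πw-rank n z) ℤ.+ (if p ℓ then - sgn (Πw-rank n z) else + 0)
        ≡⟨ cancel (p ℓ) ⟩
      (if p ℓ then + 0 else sgn (Πw-rank n z)) ∎
      where
      open ≡-Reasoning
      term : Label n → ℤ
      term ℓ' = if isCover? z ℓ' ∧ p ℓ' then weighted below-sgn k (z ⋆ ℓ') (nonascent ℓ') else + 0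
      W = weighted below-sgn k (z ⋆ ℓ) (nonascent ℓ)
      W≡ : W ≡ - sgn (Πw-rank n z)
      W≡ = trans (weighted-≤ k (nonascent ℓ) (⋆-valid ℓ vz mg)
                    (ℕₚ.≤-pred (subst (_≤ suc k) (#mins-⋆ ℓ vz mg) z≤k)) c' (Linked.tail inc))
             (trans (if-false (ascends ℓ c' inc)) (cong sgn (rank-⋆ ℓ vz mg)))
      cancel : ∀ b → sgn (Πw-rank n z) ℤ.+ (if b then - sgn (Πw-rank n z) else + 0)
                   ≡ (if b then + 0 else sgn (Πw-rank n z))
      cancel true  = ℤₚ.+-inverseʳ (sgn (Πw-rank n z))
      cancel false = ℤₚ.+-identityʳ _
      off : ∀ {ℓ'} → ℓ' ∈ allLabels n → ℓ' ≢ ℓ → term ℓ' ≡ + 0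
      off {ℓ'} _ ℓ'≢ℓ = vanish k vz z≤k p ℓ' λ mg' c'' inc'' → case extend ℓ' c'' inc'' of λ
        { (inj₁ starts) → starts
        ; (inj₂ inc₂)   → contradiction
            (Listₚ.∷-injectiveˡ (increasing-unique vz (step (cover⇐ z ℓ' mg') c'') c inc₂ inc)) ℓ'≢ℓ }

  -- The Möbius function of weighted partitions

  #af : Raw n → ℕ
  #af = #ascent-free n (Πw-bot n) (λ _ → true)

  #af-pos : {x : Raw n} → Valid x → 1 ≤ #af x
  #af-pos vx = let (c , af) = ⊑⇒ascent-free Πw-bot-valid vx (Πw-bot-⊑ vx) in
    #ascent-free-pos n _ Πw-bot-valid (#mins≤n (Πw-bot n)) c af λ _ → _

  signed : Raw n → ℤ
  signed x = sgn (Πw-rank n x) ℤ.* + #af x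

  ∑-below : {x : Raw n} → Valid x →
            ℤΣ.∑ (λ t → if Πw-le n t x then signed t else + 0) (Πw-elems n) ≡ (if ⌊ Πw-bot n ≟R x ⌋ then + 1 else + 0)
  ∑-below {x} vx = trans (ℤΣ.∑-cong (Πw-elems n) λ {t} _ → if-* (Πw-le n t x))
    (trans (weighted-≤ vx n _ Πw-bot-valid (#mins≤n (Πw-bot n)) c inc) (start c))
    where
    c = proj₁ (⊑⇒increasing Πw-bot-valid vx (Πw-bot-⊑ vx))
    inc = proj₂ (⊑⇒increasing Πw-bot-valid vx (Πw-bot-⊑ vx))
    if-* : ∀ b {i j} → (if b then i ℤ.* j else + 0) ≡ (if b then i else + 0) ℤ.* j
    if-* true      = refl
    if-* false {j = j} = sym (ℤₚ.*-zeroˡ j)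
    start : ∀ {x} (c : Chain (Πw-bot n) x) →
            (if startsIn (λ _ → true) c then + 0 else sgn (Πw-rank n (Πw-bot n))) ≡
            (if ⌊ Πw-bot n ≟R x ⌋ then + 1 else + 0)
    start done = trans (cong sgn (Πw-rank-bot {n})) (sym (if-true (T⇒≡true (fromWitness {a? = Πw-bot n ≟R Πw-bot n} refl))))
    start {x} (step {ℓ = ℓ} cov c) with mg , refl ← cover⇒ (Πw-bot n) ℓ cov =
      sym (if-false (¬T⇒≡false λ h →
        acyclic ℓ Πw-bot-valid mg (subst (Chain _) (sym (toWitness {a? = Πw-bot n ≟R x} h)) c)))

  private module M = Moebius (Πw-elems n) (Πw-le n) (Πw-bot n) (Πw-rank n)

  le-bot⇒≡ : {x : Raw n} → Valid x → T (Πw-le n x (Πw-bot n)) → x ≡ Πw-bot n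
  le-bot⇒≡ vx h = chain-antisym vx (le⇒chain h) (bot-chain vx)

  bot-le : {x : Raw n} → Valid x → T (Πw-le n (Πw-bot n) x)
  bot-le vx = chain⇒le Πw-bot-valid (bot-chain vx)

  signed-bot : signed (Πw-bot n) ≡ + 1
  signed-bot = begin
    signed (Πw-bot n) ≡⟨ if-true (T⇒≡true (bot-le Πw-bot-valid)) ⟨
    (if Πw-le n (Πw-bot n) (Πw-bot n) then signed (Πw-bot n) else + 0)
      ≡⟨ ℤΣ.∑-single (Πw-elems n) (Πw-unique n) (Πw-complete Πw-bot-valid) (λ t∈ t≢ →
           if-false (¬T⇒≡false (t≢ ∘ le-bot⇒≡ (Πw-sound t∈)))) ⟨
    ℤΣ.∑ (λ t → if Πw-le n t (Πw-bot n) then signed t else + 0) (Πw-elems n)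
      ≡⟨ ∑-below Πw-bot-valid ⟩
    (if ⌊ Πw-bot n ≟R Πw-bot n ⌋ then + 1 else + 0)
      ≡⟨ if-true (T⇒≡true (fromWitness {a? = Πw-bot n ≟R Πw-bot n} refl)) ⟩
    + 1 ∎
    where open ≡-Reasoning

  signed-rec : {x : Raw n} → Valid x → x ≢ Πw-bot n →
               signed x ≡ - ℤΣ.∑ signed (filterᵇ (λ t → M.lt t x) (Πw-elems n))
  signed-rec {x} vx x≢bot = begin
    signed x ≡⟨ ℤₚ.+-identityˡ _ ⟨
    + 0 ℤ.+ signed x ≡⟨ cong (ℤ._+ signed x) (ℤₚ.+-inverseˡ S) ⟨
    - S ℤ.+ S ℤ.+ signed x ≡⟨ ℤₚ.+-assoc (- S) S _ ⟩
    - S ℤ.+ (S ℤ.+ signed x) ≡⟨ cong (λ i → - S ℤ.+ i) total ⟩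
    - S ℤ.+ + 0 ≡⟨ ℤₚ.+-identityʳ _ ⟩
    - S ∎
    where
    open ≡-Reasoning
    els = Πw-elems n
    S = ℤΣ.∑ signed (filterᵇ (λ t → M.lt t x) els)
    atx : Raw n → ℤ
    atx t = if ⌊ t ≟R x ⌋ then signed t else + 0
    atx-x : atx x ≡ signed x
    atx-x = if-true (T⇒≡true (fromWitness {a? = x ≟R x} refl))
    split : ∀ {t} → t ∈ els → (if Πw-le n t x then signed t else + 0) ≡
                              (if M.lt t x then signed t else + 0) ℤ.+ atx t
    split {t} t∈ with t ≟R x
    ... | yes refl = trans (if-true (T⇒≡true (chain⇒le vx done)))
                       (sym (trans (cong (ℤ._+ signed t) (if-false (¬T⇒≡false λ h →
                          proj₂ (M.lt⇒ h) (chain⇒le vx done)))) (ℤₚ.+-identityˡ _)))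
    ... | no t≢x = trans (cong (λ b → if b then signed t else + 0) le≡lt) (sym (ℤₚ.+-identityʳ _))
      where
      le≡lt : Πw-le n t x ≡ M.lt t x
      le≡lt with T? (Πw-le n t x)
      ... | yes h = trans (T⇒≡true h) (sym (T⇒≡true (M.lt⇐ h λ h' →
                      t≢x (chain-antisym (Πw-sound t∈) (le⇒chain h) (le⇒chain h')))))
      ... | no h  = trans (¬T⇒≡false h) (sym (¬T⇒≡false (h ∘ proj₁ ∘ M.lt⇒)))
    total : S ℤ.+ signed x ≡ + 0
    total = begin
      S ℤ.+ signed x
        ≡⟨ cong₂ ℤ._+_ (ℤΣ.∑-filterᵇ signed (λ t → M.lt t x) els)
             (trans (sym atx-x) (sym (ℤΣ.∑-single els (Πw-unique n) (Πw-complete vx) λ {t} _ t≢x →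
               if-false (¬T⇒≡false λ h → t≢x (toWitness {a? = t ≟R x} h))))) ⟩
      ℤΣ.∑ (λ t → if M.lt t x then signed t else + 0) els ℤ.+ ℤΣ.∑ atx els
        ≡⟨ ℤΣ.∑-∙ _ atx els ⟨
      ℤΣ.∑ (λ t → (if M.lt t x then signed t else + 0) ℤ.+ atx t) els
        ≡⟨ ℤΣ.∑-cong els split ⟨
      ℤΣ.∑ (λ t → if Πw-le n t x then signed t else + 0) els
        ≡⟨ ∑-below vx ⟩
      (if ⌊ Πw-bot n ≟R x ⌋ then + 1 else + 0)
        ≡⟨ if-false (¬T⇒≡false λ h → x≢bot (sym (toWitness {a? = Πw-bot n ≟R x} h))) ⟩
      + 0 ∎

  μ₀≡signed : {x : Raw n} → Valid x → M.μ₀ x ≡ signed x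
  μ₀≡signed vx = M.μ₀-unique
    (λ x∈ y∈ z∈ p q → chain⇒le (Πw-sound x∈) (chain-++ (le⇒chain p) (le⇒chain q)))
    signed
    (λ x∈ h → trans (cong signed (le-bot⇒≡ (Πw-sound x∈) h)) signed-bot)
    (λ x∈ h → signed-rec (Πw-sound x∈) λ { refl → h (bot-le Πw-bot-valid) })
    (Πw-complete vx)

-- Posets given by a list of elements

lookup-injective : ∀ {A : Set} {L : List A} → Unique L → ∀ i j → lookup L i ≡ lookup L j → i ≡ j
lookup-injective (_ ∷ u)   Fin.zero    Fin.zero    _  = refl
lookup-injective (x∉ ∷ u)  Fin.zero    (Fin.suc j) eq = contradiction eq (All.lookup x∉ (∈-lookup j))
lookup-injective (x∉ ∷ u)  (Fin.suc i) Fin.zero    eq = contradiction (sym eq) (All.lookup x∉ (∈-lookup i))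
lookup-injective (_ ∷ u)   (Fin.suc i) (Fin.suc j) eq = cong Fin.suc (lookup-injective u i j eq)

module _ {A : Set} (L : List A) (le : A → A → Bool) (bot : Fin (length L)) (rank : A → ℕ) where
  private
    module I = Whitney (allFin (length L)) (λ i j → le (lookup L i) (lookup L j)) bot (rank ∘ lookup L)
    module E = Whitney L le (lookup L bot) rank

  mob-lookup : ∀ k i → I.mob k i ≡ E.mob k (lookup L i)
  mob-lookup zero    i = refl
  mob-lookup (suc k) i with le (lookup L i) (lookup L bot)
  ... | true  = refl
  ... | false = cong -_ (begin
    I.sumℤ (map (I.mob k) belowᴵ)    ≡⟨ ℤΣ.∑-foldr (I.mob k) belowᴵ ⟩
    ℤΣ.∑ (I.mob k) belowᴵ            ≡⟨ ℤΣ.∑-cong belowᴵ (λ {j} _ → mob-lookup k j) ⟩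
    ℤΣ.∑ (E.mob k ∘ lookup L) belowᴵ ≡⟨ ℤΣ.∑-reindex (E.mob k) (λ z → E.lt z (lookup L i)) L ⟩
    ℤΣ.∑ (E.mob k) belowᴱ            ≡⟨ ℤΣ.∑-foldr (E.mob k) belowᴱ ⟨
    E.sumℤ (map (E.mob k) belowᴱ)    ∎)
    where
    open ≡-Reasoning
    belowᴵ = filterᵇ (λ j → I.lt j i) (allFin (length L))
    belowᴱ = filterᵇ (λ z → E.lt z (lookup L i)) L

  Whitney₂-lookup : ∀ k → I.W k ≡ E.W k
  Whitney₂-lookup k = begin
    length (I.ofRank k)                ≡⟨ length-∑ (I.ofRank k) ⟩
    ∑ (λ _ → 1) (I.ofRank k)           ≡⟨ ∑-reindex (λ _ → 1) (λ x → rank x ℕ.≡ᵇ k) L ⟩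
    ∑ (λ _ → 1) (E.ofRank k)           ≡⟨ length-∑ (E.ofRank k) ⟨
    length (E.ofRank k)                ∎
    where open ≡-Reasoning

  Whitney₁-lookup : ∀ k → I.w k ≡ ℤΣ.∑ E.μ₀ (E.ofRank k)
  Whitney₁-lookup k = begin
    I.sumℤ (map I.μ₀ (I.ofRank k))     ≡⟨ ℤΣ.∑-foldr I.μ₀ (I.ofRank k) ⟩
    -- The fuel is the length of `allFin (length L)` on one side and that of `L` on the other.
    ℤΣ.∑ I.μ₀ (I.ofRank k)             ≡⟨ ℤΣ.∑-cong (I.ofRank k) (λ {i} _ → trans (mob-lookup (length (allFin (length L))) i)
                                            (cong (λ m → E.mob m (lookup L i)) length-allFin)) ⟩
    ℤΣ.∑ (E.μ₀ ∘ lookup L) (I.ofRank k) ≡⟨ ℤΣ.∑-reindex E.μ₀ (λ x → rank x ℕ.≡ᵇ k) L ⟩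
    ℤΣ.∑ E.μ₀ (E.ofRank k)             ∎
    where
    open ≡-Reasoning
    length-allFin : length (allFin (length L)) ≡ length L
    length-allFin = Listₚ.length-tabulate {n = length L} (λ j → j)

-- Ladders

-- Rank `k` gets `a k` elements, of which the first `b k` have Möbius value `sgn k` and the others
-- 0. By `b≥2`, a positive rank below a nonempty one has two elements of nonzero value.
module Ladder (N : ℕ) (a b : ℕ → ℕ)
              (a≡0 : ∀ k → N ≤ k → a k ≡ 0) (a₀ : a 0 ≡ 1) (b₀ : b 0 ≡ 1) (a₁ : a 1 ≡ b 1)
              (b≤a : ∀ k → b k ≤ a k) (b≥2 : ∀ k → 1 ≤ a (suc (suc k)) → 2 ≤ b (suc k)) where

  El : Set
  El = ℕ × ℕ

  els : List El
  els = concatMap (λ k → map (k ,_) (upTo (a k))) (upTo N)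

  rank : El → ℕ
  rank = proj₁

  -- The elements (k , 0) and (k , 1) lie below everything of rank at least
  -- k + 2; (k , 0) lies below all elements of rank k + 1, and (k , 1) only
  -- below the first b (k + 1) of them.  An element of rank k + 2 that covers
  -- just one element has Möbius value 0.
  _⊏_ : El → El → Set
  (k , i) ⊏ (l , j) = k < l × (i ≡ 0 ⊎ (i ≡ 1 × (suc k < l ⊎ j < b l)))

  _⊏?_ : ∀ x y → Dec (x ⊏ y)
  (k , i) ⊏? (l , j) =
    (k ℕ.<? l) ×-dec ((i ℕ.≟ 0) ⊎-dec ((i ℕ.≟ 1) ×-dec ((suc k ℕ.<? l) ⊎-dec (j ℕ.<? b l))))

  _≟El_ : (x y : El) → Dec (x ≡ y)
  _≟El_ = ≡-dec× ℕ._≟_ ℕ._≟_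

  le : El → El → Bool
  le x y = ⌊ (x ≟El y) ⊎-dec (x ⊏? y) ⌋

  le⇒ : ∀ {x y} → T (le x y) → x ≡ y ⊎ x ⊏ y
  le⇒ {x} {y} = toWitness {a? = (x ≟El y) ⊎-dec (x ⊏? y)}

  le⇐ : ∀ {x y} → x ≡ y ⊎ x ⊏ y → T (le x y)
  le⇐ {x} {y} = fromWitness {a? = (x ≟El y) ⊎-dec (x ⊏? y)}

  ⊏-trans : ∀ {x y z} → x ⊏ y → y ⊏ z → x ⊏ z
  ⊏-trans (k<l , inj₁ i≡0)       (l<m , _) = ℕₚ.<-trans k<l l<m , inj₁ i≡0
  ⊏-trans (k<l , inj₂ (i≡1 , _)) (l<m , _) =
    ℕₚ.<-trans k<l l<m , inj₂ (i≡1 , inj₁ (ℕₚ.≤-<-trans k<l l<m))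

  le-trans : ∀ {x y z} → T (le x y) → T (le y z) → T (le x z)
  le-trans {x} {y} {z} p q with le⇒ {x} {y} p | le⇒ {y} {z} q
  ... | inj₁ refl | _         = q
  ... | inj₂ _    | inj₁ refl = p
  ... | inj₂ x⊏y  | inj₂ y⊏z  = le⇐ (inj₂ (⊏-trans x⊏y y⊏z))

  le-antisym : ∀ {x y} → T (le x y) → T (le y x) → x ≡ y
  le-antisym {x} {y} p q with le⇒ {x} {y} p | le⇒ {y} {x} q
  ... | inj₁ eq        | _               = eq
  ... | inj₂ _         | inj₁ eq         = sym eq
  ... | inj₂ (k<l , _) | inj₂ (l<k , _)  = contradiction l<k (ℕₚ.<-asym k<l)

  ∈els⇒ : ∀ {k i} → (k , i) ∈ els → i < a k
  ∈els⇒ p with l , _ , q ← find (∈-concatMap⁻ (λ k → map (k ,_) (upTo (a k))) {xs = upTo N} p)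
    with _ , r , refl ← ∈-map⁻ (l ,_) q = ∈-upTo⁻ r

  ∈els⇐ : ∀ {k i} → i < a k → (k , i) ∈ els
  ∈els⇐ {k} i<a with N ℕ.≤? k
  ... | yes N≤k = contradiction (subst (_ <_) (a≡0 k N≤k) i<a) λ ()
  ... | no N≰k  = ∈-concatMap⁺ (λ k → map (k ,_) (upTo (a k)))
                    (lose (∈-upTo⁺ (ℕₚ.≰⇒> N≰k)) (∈-map⁺ (k ,_) (∈-upTo⁺ i<a)))

  els-unique : Unique els
  els-unique = Uniqueₚ.concat⁺
    (Allₚ.map⁺ (All.tabulate λ _ → Uniqueₚ.map⁺ (λ { refl → refl }) (Uniqueₚ.upTo⁺ _)))
    (AllPairsₚ.map⁺ (AllPairs.map disjoint (Uniqueₚ.upTo⁺ N)))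
    where
    disjoint : ∀ {k l} → k ≢ l → ∀ {v} → ¬ (v ∈ map (k ,_) (upTo (a k)) × v ∈ map (l ,_) (upTo (a l)))
    disjoint {k} {l} k≢l (p , q) with _ , _ , refl ← ∈-map⁻ (k ,_) p | _ , _ , refl ← ∈-map⁻ (l ,_) q = k≢l refl

  -- Width propagates downwards: a nonempty rank makes the rank below it wide, hence nonempty, as
  -- long as ranks stay positive.
  wide : ∀ l {m} → m ≤ l → 1 ≤ a (suc (suc l)) → 2 ≤ b (suc m)
  wide zero    z≤n   1≤a = b≥2 zero 1≤a
  wide (suc l) m≤l+1 1≤a with ℕₚ.m≤n⇒m<n∨m≡n m≤l+1
  ... | inj₂ refl        = b≥2 (suc l) 1≤a
  ... | inj₁ (s≤s m≤l) = wide l m≤l (ℕₚ.≤-trans (ℕₚ.<⇒≤ (b≥2 (suc l) 1≤a)) (b≤a (suc (suc l))))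

  0̂∈els : (0 , 0) ∈ els
  0̂∈els = ∈els⇐ (subst (0 <_) (sym a₀) (s≤s z≤n))

  0̂-min : ∀ {x} → x ∈ els → T (le (0 , 0) x)
  0̂-min {zero  , i} x∈ = le⇐ (inj₁ (cong (0 ,_) (sym (ℕₚ.n<1⇒n≡0 (subst (i <_) a₀ (∈els⇒ x∈))))))
  0̂-min {suc k , i} x∈ = le⇐ {0 , 0} {suc k , i} (inj₂ (s≤s z≤n , inj₁ refl))

  rank-cover : ∀ {x y} → x ∈ els → y ∈ els → T (le x y) → x ≢ y →
               (∀ {z} → z ∈ els → T (le x z) → T (le z y) → z ≡ x ⊎ z ≡ y) → rank y ≡ suc (rank x)
  rank-cover {k , i} {l , j} x∈ y∈ x≤y x≢y cover with le⇒ {k , i} {l , j} x≤y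
  ... | inj₁ x≡y = contradiction x≡y x≢y
  ... | inj₂ (k<l , special) with ℕₚ.m≤n⇒m<n∨m≡n k<l
  ...   | inj₂ eq   = sym eq
  -- When the ranks differ by two or more, `(suc k , 0)` lies strictly between; it is above
  -- `(k , 1)` too, being among the first `b (suc k)` elements of its rank.
  ...   | inj₁ sk<l = case cover (∈els⇐ (ℕₚ.<-≤-trans 0<b (b≤a (suc k)))) (le⇐ (inj₂ (ℕₚ.≤-refl , x-special special)))
                                 (le⇐ (inj₂ (sk<l , inj₁ refl))) of λ
    { (inj₁ eq) → contradiction (sym (cong proj₁ eq)) (ℕₚ.<⇒≢ ℕₚ.≤-refl)
    ; (inj₂ eq) → contradiction (cong proj₁ eq) (ℕₚ.<⇒≢ sk<l) }
    where
    0<b : 0 < b (suc k)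
    0<b = 0<b′ sk<l (ℕₚ.≤-trans (s≤s z≤n) (∈els⇒ y∈))
      where
      0<b′ : ∀ {l} → suc k < l → 1 ≤ a l → 0 < b (suc k)
      0<b′ (s≤s (s≤s k≤l)) 1≤a = ℕₚ.<⇒≤ (wide _ k≤l 1≤a)
    x-special : i ≡ 0 ⊎ (i ≡ 1 × (suc k < l ⊎ j < b l)) → i ≡ 0 ⊎ (i ≡ 1 × (suc k < suc k ⊎ 0 < b (suc k)))
    x-special (inj₁ p)       = inj₁ p
    x-special (inj₂ (p , _)) = inj₂ (p , inj₂ 0<b)

  bot : Fin (length els)
  bot = Any.index 0̂∈els

  lookup-bot : lookup els bot ≡ (0 , 0)
  lookup-bot = sym (lookup-index 0̂∈els)

  Q : GradedPoset
  Q = record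
    { m          = length els
    ; le         = λ i j → le (lookup els i) (lookup els j)
    ; bot        = bot
    ; rank       = rank ∘ lookup els
    ; le-refl    = λ i → le⇐ {lookup els i} (inj₁ refl)
    ; le-antisym = λ i j p q → lookup-injective els-unique i j (le-antisym p q)
    ; le-trans   = λ i j k p q → le-trans {lookup els i} {lookup els j} {lookup els k} p q
    ; bot-min    = λ i → subst (λ z → T (le z (lookup els i))) (sym lookup-bot) (0̂-min (∈-lookup i))
    ; rank-bot   = cong rank lookup-bot
    ; rank-cover = λ i j p i≢j cover → rank-cover (∈-lookup i) (∈-lookup j) p (i≢j ∘ lookup-injective els-unique i j)
        λ {z} z∈ p q → let eq = lookup-index z∈ in
          case cover (Any.index z∈) (subst (λ z → T (le (lookup els i) z)) eq p)
                                    (subst (λ z → T (le z (lookup els j))) eq q) of λ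
            { (inj₁ r) → inj₁ (trans eq (cong (lookup els) r))
            ; (inj₂ r) → inj₂ (trans eq (cong (lookup els) r)) } }

  private module M = Moebius els le (lookup els bot) rank

  ν : El → ℤ
  ν (k , i) = if ⌊ i ℕ.<? b k ⌋ then sgn k else + 0

  ν-< : ∀ {k i} → i < b k → ν (k , i) ≡ sgn k
  ν-< {k} {i} p = if-true (T⇒≡true (fromWitness {a? = i ℕ.<? b k} p))

  lt⇒⊏ : ∀ {x y} → T (M.lt x y) → x ⊏ y
  lt⇒⊏ {x} {y} h with le⇒ {x} {y} (proj₁ (M.lt⇒ h))
  ... | inj₁ refl = contradiction (le⇐ {x} (inj₁ refl)) (proj₂ (M.lt⇒ {x} {y} h))
  ... | inj₂ x⊏y  = x⊏y

  ⊏⇒lt : ∀ {x y} → x ⊏ y → T (M.lt x y)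
  ⊏⇒lt {x} {y} x⊏y = M.lt⇐ {x} {y} (le⇐ (inj₂ x⊏y)) λ h → case le⇒ {y} {x} h of λ
    { (inj₁ refl)      → ℕₚ.<-irrefl refl (proj₁ x⊏y)
    ; (inj₂ (l<k , _)) → ℕₚ.<-asym (proj₁ x⊏y) l<k }

  module Below (k i : ℕ) (i<a : i < a (suc k)) where

    term : ℕ → ℕ → ℤ
    term l j = if M.lt (l , j) (suc k , i) then ν (l , j) else + 0

    row : ℕ → ℤ
    row l = ℤΣ.∑ (term l) (upTo (a l))

    term-⊏ : ∀ {l j} → (l , j) ⊏ (suc k , i) → term l j ≡ ν (l , j)
    term-⊏ {l} {j} h = if-true (T⇒≡true (⊏⇒lt {l , j} h))

    term-⋢ : ∀ {l j} → ¬ ((l , j) ⊏ (suc k , i)) → term l j ≡ + 0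
    term-⋢ {l} {j} h = if-false (¬T⇒≡false (h ∘ lt⇒⊏ {l , j}))

    ∑-filter : ℤΣ.∑ ν (filterᵇ (λ z → M.lt z (suc k , i)) els) ≡ ℤΣ.∑ row (upTo N)
    ∑-filter = trans (ℤΣ.∑-filterᵇ ν (λ z → M.lt z (suc k , i)) els)
      (trans (ℤΣ.∑-concatMap _ _ (upTo N))
             (ℤΣ.∑-cong (upTo N) λ {l} _ → ℤΣ.∑-map _ (l ,_) (upTo (a l))))

    row₀ : row 0 ≡ + 1
    row₀ = trans (cong (λ m → ℤΣ.∑ (term 0) (upTo m)) a₀)
      (trans (ℤₚ.+-identityʳ _) (trans (term-⊏ (s≤s z≤n , inj₁ refl)) (ν-< (subst (0 <_) (sym b₀) (s≤s z≤n)))))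

    row≥ : ∀ {l} → suc k ≤ l → row l ≡ + 0
    row≥ {l} k<l = ℤΣ.∑-zero (upTo (a l)) λ {j} _ → term-⋢ {l} {j} λ h → ℕₚ.<⇒≱ (proj₁ h) k<l

    two-terms : ∀ (f : ℕ → ℤ) {m} → 2 ≤ m → (∀ j → f (suc (suc j)) ≡ + 0) → ℤΣ.∑ f (upTo m) ≡ f 0 ℤ.+ f 1
    two-terms f 2≤m f≡0 = trans (ℤΣ.∑-upTo-stable f 2≤m λ { (s≤s (s≤s _)) → f≡0 _ })
      (cong (λ i → f 0 ℤ.+ i) (ℤₚ.+-identityʳ (f 1)))

    row-suc : ∀ {l} → suc l < suc k → 2 ≤ b (suc l) → row (suc l) ≡ sgn (suc l) ℤ.+ term (suc l) 1
    row-suc {l} l<k 2≤b = trans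
      (two-terms (term (suc l)) (ℕₚ.≤-trans 2≤b (b≤a (suc l))) λ j → term-⋢ {suc l} λ
         { (_ , inj₁ ()) ; (_ , inj₂ (() , _)) })
      (cong (ℤ._+ term (suc l) 1) (trans (term-⊏ (l<k , inj₁ refl)) (ν-< (ℕₚ.<⇒≤ 2≤b))))

    -- Row 0 gives 1, and each later row at least two ranks below the top gives two equal terms,
    -- turning the running sum `sgn m` into `sgn (suc m)`. A later row right below the top is
    -- excluded, as its second term may be missing.
    partial : ∀ m → m < suc k → (m ≡ 0 ⊎ m < k) → ℤΣ.∑ row (upTo (suc m)) ≡ sgn m
    partial zero    _   _         = trans (ℤₚ.+-identityʳ _) row₀
    partial (suc m) m<k (inj₂ lt) = begin
      ℤΣ.∑ row (upTo (suc (suc m)))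
        ≡⟨ ℤΣ.∑-upTo-suc row (suc m) ⟩
      ℤΣ.∑ row (upTo (suc m)) ℤ.+ row (suc m)
        ≡⟨ cong₂ ℤ._+_ (partial m (ℕₚ.<-trans (ℕₚ.n<1+n m) m<k) (inj₂ (ℕₚ.<-trans (ℕₚ.n<1+n m) lt)))
             (trans (row-suc m<k 2≤b) (cong (λ i → sgn (suc m) ℤ.+ i)
               (trans (term-⊏ (m<k , inj₂ (refl , inj₁ (s≤s lt)))) (ν-< 2≤b)))) ⟩
      sgn m ℤ.+ (- sgn m ℤ.+ - sgn m)
        ≡⟨ ℤₚ.+-assoc (sgn m) _ _ ⟨
      sgn m ℤ.+ - sgn m ℤ.+ - sgn m
        ≡⟨ cong (ℤ._+ - sgn m) (ℤₚ.+-inverseʳ (sgn m)) ⟩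
      + 0 ℤ.+ - sgn m
        ≡⟨ ℤₚ.+-identityˡ _ ⟩
      sgn (suc m) ∎
      where
      open ≡-Reasoning
      2≤b = 2≤b′ lt i<a
        where
        2≤b′ : ∀ {k} → suc m < k → i < a (suc k) → 2 ≤ b (suc m)
        2≤b′ (s≤s sm≤k) i<a = wide _ (ℕₚ.<⇒≤ sm≤k) (ℕₚ.≤-trans (s≤s z≤n) i<a)

    neg-ν : ν (suc k , i) ≡ - (if ⌊ i ℕ.<? b (suc k) ⌋ then sgn k else + 0)
    neg-ν with ⌊ i ℕ.<? b (suc k) ⌋
    ... | true  = refl
    ... | false = refl

    -- The last row decides: its first term brings the sum to 0, and its second, if present, to
    -- `sgn k`. The copy `k'` makes a case split on the module parameter possible.
    total : ∀ k' → k ≡ k' → ℤΣ.∑ row (upTo (suc k)) ≡ (if ⌊ i ℕ.<? b (suc k) ⌋ then sgn k else + 0)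
    -- Only the minimum lies below rank 1, so every value there is -1; `a 1 = b 1` gives `i < b 1`.
    total zero refl = trans (partial 0 (s≤s z≤n) (inj₁ refl))
      (sym (if-true (T⇒≡true (fromWitness {a? = i ℕ.<? b 1} (subst (i <_) a₁ i<a)))))
    total (suc m) refl = begin
      ℤΣ.∑ row (upTo (suc (suc m)))
        ≡⟨ ℤΣ.∑-upTo-suc row (suc m) ⟩
      ℤΣ.∑ row (upTo (suc m)) ℤ.+ row (suc m)
        ≡⟨ cong₂ ℤ._+_ (partial m (s≤s (ℕₚ.n≤1+n m)) (inj₂ ℕₚ.≤-refl)) (row-suc ℕₚ.≤-refl 2≤b) ⟩
      sgn m ℤ.+ (- sgn m ℤ.+ term (suc m) 1)
        ≡⟨ ℤₚ.+-assoc (sgn m) _ _ ⟨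
      sgn m ℤ.+ - sgn m ℤ.+ term (suc m) 1
        ≡⟨ cong (ℤ._+ term (suc m) 1) (ℤₚ.+-inverseʳ (sgn m)) ⟩
      + 0 ℤ.+ term (suc m) 1
        ≡⟨ ℤₚ.+-identityˡ _ ⟩
      term (suc m) 1
        ≡⟨ last ⟩
      (if ⌊ i ℕ.<? b (suc (suc m)) ⌋ then sgn (suc m) else + 0) ∎
      where
      open ≡-Reasoning
      2≤b = b≥2 m (ℕₚ.≤-trans (s≤s z≤n) i<a)
      last : term (suc m) 1 ≡ (if ⌊ i ℕ.<? b (suc (suc m)) ⌋ then sgn (suc m) else + 0)
      last = case i ℕ.<? b (suc (suc m)) of λ
        { (yes p) → trans (trans (term-⊏ (ℕₚ.≤-refl , inj₂ (refl , inj₂ p))) (ν-< 2≤b))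
                      (sym (if-true (T⇒≡true (fromWitness {a? = i ℕ.<? b (suc (suc m))} p))))
        ; (no ¬p) → trans (term-⋢ {suc m} λ
                        { (_ , inj₁ ())
                        ; (_ , inj₂ (_ , inj₁ lt)) → ℕₚ.<-irrefl refl lt
                        ; (_ , inj₂ (_ , inj₂ p))  → ¬p p })
                      (sym (if-false (¬T⇒≡false (¬p ∘ toWitness {a? = i ℕ.<? b (suc (suc m))})))) }

    ν-rec : ν (suc k , i) ≡ - ℤΣ.∑ ν (filterᵇ (λ z → M.lt z (suc k , i)) els)
    ν-rec = trans neg-ν (cong -_ (trans (sym (total k refl))
      (trans (sym (ℤΣ.∑-upTo-stable row k<N row≥)) (sym ∑-filter))))
      where
      k<N : suc k ≤ N
      k<N = ℕₚ.≮⇒≥ λ N<k → case subst (i <_) (a≡0 (suc k) (ℕₚ.<⇒≤ N<k)) i<a of λ ()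

  μ₀≡ν : ∀ {x} → x ∈ els → M.μ₀ x ≡ ν x
  μ₀≡ν = M.μ₀-unique (λ {x} {y} {z} _ _ _ → le-trans {x} {y} {z}) ν
    (λ x∈ h → trans (cong ν (trans (le-antisym h (subst (λ z → T (le z _)) (sym lookup-bot) (0̂-min x∈))) lookup-bot))
                    (ν-< (subst (0 <_) (sym b₀) (s≤s z≤n))))
    λ { {zero  , i} x∈ h → contradiction (le⇐ (inj₁ (trans
                             (cong (0 ,_) (ℕₚ.n<1⇒n≡0 (subst (i <_) a₀ (∈els⇒ x∈)))) (sym lookup-bot)))) h
      ; {suc k , i} x∈ h → Below.ν-rec k i (∈els⇒ x∈) }

  W-Q : ∀ k → QW.W Q k ≡ a k
  W-Q k = begin
    QW.W Q k                       ≡⟨ Whitney₂-lookup els le bot rank k ⟩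
    M.W k                          ≡⟨ length-∑ (M.ofRank k) ⟩
    ∑ (λ _ → 1) (M.ofRank k)       ≡⟨ ∑-fibre a N a≡0 (λ _ → 1) k ⟩
    ∑ (λ _ → 1) (upTo (a k))       ≡⟨ length-∑ (upTo (a k)) ⟨
    length (upTo (a k))            ≡⟨ Listₚ.length-upTo (a k) ⟩
    a k                            ∎
    where open ≡-Reasoning

  w-Q : ∀ k → ℤ.∣ QW.w Q k ∣ ≡ b k
  w-Q k = trans (cong ℤ.∣_∣ (begin
    QW.w Q k                            ≡⟨ Whitney₁-lookup els le bot rank k ⟩
    ℤΣ.∑ M.μ₀ (M.ofRank k)              ≡⟨ ℤΣ.∑-cong (M.ofRank k) (λ x∈ →
                                             μ₀≡ν (proj₁ (∈-filter⁻ (T? ∘ λ x → rank x ℕ.≡ᵇ k) {xs = els} x∈))) ⟩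
    ℤΣ.∑ ν (M.ofRank k)                 ≡⟨ ℤΣ.∑-fibre a N a≡0 ν k ⟩
    ℤΣ.∑ (λ j → ν (k , j)) (upTo (a k)) ≡⟨ ℤΣ.∑-upTo-stable (λ j → ν (k , j)) (b≤a k) (λ {j} b≤j →
                                             if-false (¬T⇒≡false λ h → ℕₚ.<⇒≱ (toWitness {a? = j ℕ.<? b k} h) b≤j)) ⟩
    ℤΣ.∑ (λ j → ν (k , j)) (upTo (b k)) ≡⟨ ℤΣ.∑-cong (upTo (b k)) (λ j∈ →
                                             trans (ν-< (∈-upTo⁻ j∈)) (sym (ℤₚ.*-identityʳ (sgn k)))) ⟩
    ℤΣ.∑ (λ _ → sgn k ℤ.* + 1) (upTo (b k)) ≡⟨ *-∑ (sgn k) (λ _ → + 1) (upTo (b k)) ⟨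
    sgn k ℤ.* ℤΣ.∑ (λ _ → + 1) (upTo (b k)) ≡⟨ cong (sgn k ℤ.*_) (pos-∑ (λ _ → 1) (upTo (b k))) ⟨
    sgn k ℤ.* + ∑ (λ _ → 1) (upTo (b k)) ≡⟨ cong (λ m → sgn k ℤ.* + m)
                                             (trans (sym (length-∑ (upTo (b k)))) (Listₚ.length-upTo (b k))) ⟩
    sgn k ℤ.* + b k ∎)) (∣sgn*∣ k (b k))
    where open ≡-Reasoning

-- Whitney numbers of weighted partitions and the dual

2≤length : ∀ {A : Set} {x y : A} {L} → x ∈ L → y ∈ L → x ≢ y → 2 ≤ length L
2≤length (here refl) (here refl) x≢y = contradiction refl x≢y
2≤length (here refl) (there {xs = _ ∷ _} y∈) _ = s≤s (s≤s z≤n)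
2≤length (there {xs = _ ∷ _} x∈) _ _ = s≤s (s≤s z≤n)

module _ (n : ℕ) where
  private
    module M = Moebius (Πw-elems n) (Πw-le n) (Πw-bot n) (Πw-rank n)
    0̂ = Πw-bot n
    rank = Πw-rank n

  ∈ofRank⇒ : ∀ {k x} → x ∈ M.ofRank k → Valid x × rank x ≡ k
  ∈ofRank⇒ {k} x∈ with x∈els , h ← ∈-filter⁻ (T? ∘ λ x → rank x ℕ.≡ᵇ k) {xs = Πw-elems n} x∈ =
    Πw-sound x∈els , ℕₚ.≡ᵇ⇒≡ _ k h

  ∈ofRank⇐ : ∀ {k x} → Valid x → rank x ≡ k → x ∈ M.ofRank k
  ∈ofRank⇐ {k} vx eq = ∈-filter⁺ (T? ∘ λ x → rank x ℕ.≡ᵇ k) (Πw-complete vx) (ℕₚ.≡⇒≡ᵇ _ k eq)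

  ofRank-unique : ∀ k → Unique (M.ofRank k)
  ofRank-unique k = Uniqueₚ.filter⁺ (T? ∘ λ x → rank x ℕ.≡ᵇ k) (Πw-unique n)

  -- Chains are built from their first cover, whereas descending one rank from `x` needs the last
  -- one.
  chain-last : ∀ {z x : Raw n} → Valid z → Chain z x →
               z ≡ x ⊎ (∃ λ y → ∃ λ ℓ → Chain z y × Valid y × Mergeable y ℓ × x ≡ y ⋆ ℓ)
  chain-last vz done = inj₁ refl
  chain-last {z} vz (step {ℓ = ℓ} cov c) with mg , refl ← cover⇒ z ℓ cov
    with chain-last (⋆-valid ℓ vz mg) c
  ... | inj₁ refl = inj₂ (z , ℓ , done , vz , mg , refl)
  ... | inj₂ (y , ℓ' , c' , vy , mg' , eq) = inj₂ (y , ℓ' , step cov c' , vy , mg' , eq)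

  rank-0⇒≡0̂ : ∀ {x} → Valid x → rank x ≡ 0 → x ≡ 0̂
  rank-0⇒≡0̂ vx eq with chain-last Πw-bot-valid (bot-chain vx)
  ... | inj₁ p = sym p
  ... | inj₂ (y , ℓ , _ , vy , mg , refl) = contradiction (trans (sym (rank-⋆ ℓ vy mg)) eq) λ ()

  predecessor : ∀ {x k} → Valid x → rank x ≡ suc k →
                ∃ λ y → ∃ λ ℓ → Valid y × rank y ≡ k × Mergeable y ℓ × x ≡ y ⋆ ℓ
  predecessor vx eq with chain-last Πw-bot-valid (bot-chain vx)
  ... | inj₁ refl = contradiction (trans (sym (Πw-rank-bot {n})) eq) λ ()
  ... | inj₂ (y , ℓ , _ , vy , mg , refl) =
    y , ℓ , vy , ℕₚ.suc-injective (trans (sym (rank-⋆ ℓ vy mg)) eq) , mg , refl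

  ∣signed∣ : ∀ x → ℤ.∣ signed x ∣ ≡ #af x
  ∣signed∣ x = ∣sgn*∣ (rank x) (#af x)

  #af-0̂ : #af 0̂ ≡ 1
  #af-0̂ = trans (sym (∣signed∣ 0̂)) (cong ℤ.∣_∣ (signed-bot {n}))

  -- Obtained through μ instead of listing chains: only `0̂` lies below an atom, so μ is -1 there.
  #af-atom : ∀ {x} → Valid x → rank x ≡ 1 → #af x ≡ 1
  #af-atom {x} vx eq = trans (sym (∣signed∣ x)) (cong ℤ.∣_∣
    (trans (signed-rec vx x≢0̂) (cong -_ (trans
      (ℤΣ.∑-single below (Uniqueₚ.filter⁺ (T? ∘ λ t → M.lt t x) (Πw-unique n)) 0̂∈ λ t∈ t≢0̂ →
        contradiction (only-0̂ t∈) t≢0̂)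
      (signed-bot {n})))))
    where
    below = filterᵇ (λ t → M.lt t x) (Πw-elems n)
    x≢0̂ : x ≢ 0̂
    x≢0̂ refl = contradiction (trans (sym (Πw-rank-bot {n})) eq) λ ()
    0̂∈ : 0̂ ∈ below
    0̂∈ = ∈-filter⁺ (T? ∘ λ t → M.lt t x) (Πw-complete Πw-bot-valid)
           (M.lt⇐ (bot-le vx) (x≢0̂ ∘ le-bot⇒≡ vx))
    only-0̂ : ∀ {t} → t ∈ below → t ≡ 0̂
    only-0̂ {t} t∈ with t∈els , h ← ∈-filter⁻ (T? ∘ λ t → M.lt t x) {xs = Πw-elems n} t∈
      with t≤x , x≰t ← M.lt⇒ h with vt ← Πw-sound t∈els with chain-last vt (le⇒chain t≤x)
    ... | inj₁ refl = contradiction t≤x x≰t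
    ... | inj₂ (y , ℓ , c , vy , mg , refl)
      with refl ← rank-0⇒≡0̂ vy (ℕₚ.suc-injective (trans (sym (rank-⋆ ℓ vy mg)) eq)) =
      chain-antisym vt c (bot-chain vt)

  ∑-ofRank-0 : ∀ (f : Raw n → ℕ) → ∑ f (M.ofRank 0) ≡ f 0̂
  ∑-ofRank-0 f = ∑-single (M.ofRank 0) (ofRank-unique 0) (∈ofRank⇐ Πw-bot-valid (Πw-rank-bot {n}))
    λ x∈ x≢0̂ → let (vx , eq) = ∈ofRank⇒ x∈ in contradiction (rank-0⇒≡0̂ vx eq) x≢0̂

  private
    -- The two kinds trade places in the dual: `a k`, the absolute first-kind number, becomes the
    -- size of rank `k`, and `b k` the absolute Möbius sum.
    a b : ℕ → ℕ
    a k = ∑ #af (M.ofRank k)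
    b   = M.W

  ∣w∣≡a : ∀ k → ℤ.∣ M.w k ∣ ≡ a k
  ∣w∣≡a k = trans (cong ℤ.∣_∣ (begin
    M.w k                                        ≡⟨ ℤΣ.∑-foldr M.μ₀ (M.ofRank k) ⟩
    ℤΣ.∑ M.μ₀ (M.ofRank k)                       ≡⟨ ℤΣ.∑-cong (M.ofRank k) (λ {x} x∈ → let (vx , eq) = ∈ofRank⇒ x∈ in
                                                      trans (μ₀≡signed vx) (cong (λ r → sgn r ℤ.* + #af x) eq)) ⟩
    ℤΣ.∑ (λ x → sgn k ℤ.* + #af x) (M.ofRank k) ≡⟨ *-∑ (sgn k) (λ x → + #af x) (M.ofRank k) ⟨
    sgn k ℤ.* ℤΣ.∑ (λ x → + #af x) (M.ofRank k) ≡⟨ cong (sgn k ℤ.*_) (pos-∑ #af (M.ofRank k)) ⟨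
    sgn k ℤ.* + a k                              ∎)) (∣sgn*∣ k (a k))
    where open ≡-Reasoning

  -- A rank is `n` minus a number of blocks, hence at most `n`; this gives the height `suc n` of the
  -- ladder.
  a≡0 : ∀ k → suc n ≤ k → a k ≡ 0
  a≡0 k n<k = ∑-zero (M.ofRank k) λ {x} x∈ → contradiction
    (subst (_≤ n) (proj₂ (∈ofRank⇒ x∈)) (ℕₚ.m∸n≤m n (length (filterᵇ (isMin x) (allFin n))))) (ℕₚ.<⇒≱ n<k)

  b≤a : ∀ k → b k ≤ a k
  b≤a k = subst (_≤ a k) (sym (length-∑ (M.ofRank k)))
    (∑-mono-≤ (M.ofRank k) λ x∈ → #af-pos (proj₁ (∈ofRank⇒ x∈)))

  b₀ : b 0 ≡ 1
  b₀ = trans (length-∑ (M.ofRank 0)) (∑-ofRank-0 λ _ → 1)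

  a₁≡b₁ : a 1 ≡ b 1
  a₁≡b₁ = trans (∑-cong (M.ofRank 1) λ x∈ → let (vx , eq) = ∈ofRank⇒ x∈ in #af-atom vx eq)
                (sym (length-∑ (M.ofRank 1)))

  ∑-pos⇒∃ : ∀ {A : Set} (f : A → ℕ) L → 1 ≤ ∑ f L → ∃ (_∈ L)
  ∑-pos⇒∃ f (x ∷ L) _ = x , here refl

  -- The 0-merge and the 1-merge of the same two blocks give two elements.
  b≥2 : ∀ k → 1 ≤ a (suc (suc k)) → 2 ≤ b (suc k)
  b≥2 k 1≤a with x , x∈ ← ∑-pos⇒∃ #af (M.ofRank (suc (suc k))) 1≤a
    with vx , eq ← ∈ofRank⇒ x∈
    with y , _ , vy , eq' , _ ← predecessor vx eq
    with z , (i , j , _) , vz , eq″ , mg , _ ← predecessor vy eq' =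
    2≤length (∈ofRank⇐ (⋆-valid (i , j , bit0) vz mg) (trans (rank-⋆ (i , j , bit0) vz mg) (cong suc eq″)))
             (∈ofRank⇐ (⋆-valid (i , j , bit1) vz mg) (trans (rank-⋆ (i , j , bit1) vz mg) (cong suc eq″)))
             (λ same → ℕₚ.m≢1+m+n (wt z i + wt z j + 0) {0} (begin
               wt z i + wt z j + 0     ≡⟨ wt-merge-a z i j bit0 refl ⟨
               wt (merge z i j bit0) i ≡⟨ cong (λ m → wt m i) same ⟩
               wt (merge z i j bit1) i ≡⟨ wt-merge-a z i j bit1 refl ⟩
               wt z i + wt z j + 1     ≡⟨ ℕₚ.+-suc (wt z i + wt z j) 0 ⟩
               suc (wt z i + wt z j + 0) ≡⟨ cong suc (ℕₚ.+-identityʳ _) ⟨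
               suc (wt z i + wt z j + 0 + 0) ∎))
    where open ≡-Reasoning

  Πw-Whitney-dual : HasWhitneyDual-Πw n
  Πw-Whitney-dual = Q , λ k → trans (∣w∣≡a k) (sym (W-Q k)) , w-Q k
    where open Ladder (suc n) a b a≡0 (trans (∑-ofRank-0 #af) #af-0̂) b₀ a₁≡b₁ b≤a b≥2

theorem2p8 : (n : ℕ) → 1 ≤ n → λw-IsEW n × HasWhitneyDual-Πw n
theorem2p8 n _ = λw-EW n , Πw-Whitney-dual n
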